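{- Let $K$ be a compact subset of $(0,1)^2$, and let $0\le Y<\infty$. For every $\epsilon>0$ with $\epsilon<\inf_{(p,q)\in K}x_*(p,q)$, there exist constants $C<\infty$ and $0<\theta<1$ such that $$|G_h(x,y,p,q)|\le C\theta^h$$ uniformly for all $h\ge1$, all $(p,q)\in K$, all complex $y$ with $|y|\le Y$, and all complex $x$ with $|x|\le x_*(p,q)-\epsilon$.
   Context: For $h\ge0$, $P_h(X,Q)=\sum_{m=0}^{\lfloor h/2\rfloor}(-X)^mQ^{m(m-1)}\begin{bmatrix} h-m \\ m \end{bmatrix}_Q$, where $\begin{bmatrix} N \\ m \end{bmatrix}_Q$ is the Gaussian binomial polynomial in $Q$ (so $P_0=P_1=1$). Put $D_h(X,Q)=\dfrac{P_h(QX,Q)}{P_{h+1}(X,Q)}$, a rational function of $X$ (it is the generating function of Dyck paths of height at most $h$, with $X$ marking semi-length and $Q$ marking diamond area). For $h\ge1$, $$G_h(x,y,p,q)=x^hy^hq^{h^2}\left[\prod_{k=1}^{h-1}D_k\!\left(q^{2k-1}px,\tfrac{p^2}{q^2}\right)\right]^2D_h\!\left(q^{2h-1}px,\tfrac{p^2}{q^2}\right),$$ with the empty product equal to one, viewed as a rational function of $x$. (It is the generating function of Dyck paths of height exactly $h$, with $x,y,p,q$ marking semi-length, height, water capacity and proper area respectively.) For $r>0$ and $h\ge1$, $A_h(r)$ is the $h\times h$ real symmetric tridiagonal matrix with zero diagonal and $(A_h(r))_{i,i+1}=(A_h(r))_{i+1,i}=r^{(i-1)/2}$ for $1\le i\le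 h-1$; $\lambda_h(r)$ is its spectral radius and $\Lambda_h(r)=\lambda_h(r)^2$. For $p,q>0$ and $k\ge1$ put $$x_k(p,q)=\frac{1}{p^{2k-1}q\,\Lambda_{k+1}(q^2/p^2)},$$ which is the smallest positive real zero in $x$ of $P_{k+1}(p^{2k-1}qx,q^2/p^2)$. For $0<p,q<1$ put $x_*(p,q)=\min_{k\ge1}x_k(p,q)$ (the minimum is attained). -}

module Defs where

open import Level using (Level; 0ℓ)
open import Algebra.Bundles using (CommutativeRing; RawRing; Semiring)
import Algebra.Definitions.RawSemiring as RawSemiringDefs
open import Data.Bool.Base using (if_then_else_)
open import Data.Fin.Base using (Fin; toℕ)
open import Data.List.Base using (List)
open import Data.List.Relation.Unary.Any using (Any)
open import Data.Nat.Base as ℕ using (ℕ; _∸_; _≡ᵇ_; ⌊_/2⌋)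
open import Data.Product.Base using (Σ; ∃; ∃-syntax; _×_; _,_)
open import Data.Product.Relation.Binary.Pointwise.NonDependent using (Pointwise)
open import Data.Vec.Functional using (Vector)
open import Relation.Binary.Core using (Rel)
open import Relation.Binary.Structures using (IsTotalOrder)
import Relation.Binary.Construct.NonStrictToStrict as NonStrictToStrict
open import Relation.Nullary using (¬_)
open import Relation.Unary using (Pred)

-- The axioms of a Dedekind-complete ordered field, which determine the real
-- numbers up to isomorphism. Both `_⁻¹` and `sup` are total but unspecified
-- where the usual operation is undefined: at zero, and at sets that are empty
-- or unbounded above. Sets of reals need not respect `_≈_`.

record CompleteOrderedField : Set₁ where
  infix  4 _≤_
  infix  8 _⁻¹
  field
    commutativeRing : CommutativeRing 0ℓ 0ℓ

  open CommutativeRing commutativeRing public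

  field
    _≤_          : Rel Carrier 0ℓ
    isTotalOrder : IsTotalOrder _≈_ _≤_
    0≉1          : ¬ (0# ≈ 1#)
    +-monoˡ-≤    : ∀ {x y} z → x ≤ y → x + z ≤ y + z
    *-nonneg     : ∀ {x y} → 0# ≤ x → 0# ≤ y → 0# ≤ x * y

    _⁻¹          : Carrier → Carrier
    ⁻¹-cong      : ∀ {x y} → x ≈ y → x ⁻¹ ≈ y ⁻¹
    ⁻¹-inverseʳ  : ∀ {x} → ¬ (x ≈ 0#) → x * x ⁻¹ ≈ 1#

  IsUpperBound : Pred Carrier 0ℓ → Pred Carrier 0ℓ
  IsUpperBound S b = ∀ {x} → S x → x ≤ b

  field
    sup       : Pred Carrier 0ℓ → Carrier
    sup-upper : ∀ {S} → ∃ S → ∃ (IsUpperBound S) → IsUpperBound S (sup S)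
    sup-least : ∀ {S} → ∃ S → ∀ {b} → IsUpperBound S b → sup S ≤ b

  open NonStrictToStrict _≈_ _≤_ public using (_<_)

  inf : Pred Carrier 0ℓ → Carrier
  inf S = - sup (λ x → ∃[ s ] S s × x ≈ - s)

  √_ : Carrier → Carrier
  √ a = sup (λ t → t * t ≤ a)

module Polynomials {c ℓ : Level} (R : RawRing c ℓ) where
  open RawRing R
  open RawSemiringDefs rawSemiring using (_^_; sum)

  -- The value at Q of the Gaussian binomial polynomial, by the q-Pascal rule.
  gaussian : ℕ → ℕ → Carrier → Carrier
  gaussian _         ℕ.zero    Q = 1#
  gaussian ℕ.zero    (ℕ.suc m) Q = 0#
  gaussian (ℕ.suc n) (ℕ.suc m) Q =
    gaussian n m Q + Q ^ ℕ.suc m * gaussian n (ℕ.suc m) Q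

  P : ℕ → Carrier → Carrier → Carrier
  P h X Q = sum {ℕ.suc ⌊ h /2⌋} λ i → let m = toℕ i in
    (- X) ^ m * Q ^ (m ℕ.* (m ∸ 1)) * gaussian (h ∸ m) m Q

module Complex (𝓡 : CompleteOrderedField) where
  private module ℝ = CompleteOrderedField 𝓡
  open ℝ using (_+_; _*_; -_; _-_; 0#; 1#; _⁻¹; √_) renaming (Carrier to Real)

  ℂ : Set
  ℂ = Real × Real

  ℂ-rawRing : RawRing 0ℓ 0ℓ
  ℂ-rawRing = record
    { Carrier = ℂ
    ; _≈_ = Pointwise ℝ._≈_ ℝ._≈_
    ; _+_ = λ (a , b) (c , d) → a + c , b + d
    ; _*_ = λ (a , b) (c , d) → a * c - b * d , a * d + b * c
    ; -_  = λ (a , b) → - a , - b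
    ; 0#  = 0# , 0#
    ; 1#  = 1# , 0#
    }

  ι : Real → ℂ
  ι a = a , 0#

  ∣_∣ : ℂ → Real
  ∣ a , b ∣ = √ (a * a + b * b)

  _⁻¹ᶜ : ℂ → ℂ
  (a , b) ⁻¹ᶜ = a * n ⁻¹ , - b * n ⁻¹
    where n = a * a + b * b

module Analysis (𝓡 : CompleteOrderedField) where
  open CompleteOrderedField 𝓡 public
    using (_≈_; _≤_; _<_; _+_; _*_; _-_; -_; 0#; 1#; _⁻¹; √_; sup; inf)
    renaming (Carrier to ℝ)
  open RawSemiringDefs
    (Semiring.rawSemiring (CompleteOrderedField.semiring 𝓡)) public using (_^_)
  open Complex 𝓡 public using (ℂ; ℂ-rawRing; ι; ∣_∣; _⁻¹ᶜ)
  open RawRing ℂ-rawRing public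
    using () renaming (_≈_ to _≈ᶜ_; _*_ to _*ᶜ_; 0# to 0ᶜ)
  open RawSemiringDefs (RawRing.rawSemiring ℂ-rawRing) public
    using () renaming (_^_ to _^ᶜ_; sum to sumᶜ; product to productᶜ)
  open Polynomials ℂ-rawRing public using (P)

  IsOpen : Pred (ℝ × ℝ) 0ℓ → Set
  IsOpen U = ∀ p q → U (p , q) → ∃[ δ ] 0# < δ × (∀ p′ q′ →
    p - δ < p′ → p′ < p + δ → q - δ < q′ → q′ < q + δ → U (p′ , q′))

  IsCompact : Pred (ℝ × ℝ) 0ℓ → Set₁
  IsCompact K = (I : Set) (U : I → Pred (ℝ × ℝ) 0ℓ) →
    (∀ i → IsOpen (U i)) →
    (∀ z → K z → ∃[ i ] U i z) →
    Σ (List I) λ is → ∀ z → K z → Any (λ i → U i z) is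

  Matrix : ℕ → Set
  Matrix n = Fin n → Fin n → ℝ

  IsEigenvalue : ∀ {n} → Matrix n → ℂ → Set
  IsEigenvalue {n} M μ = Σ (Vector ℂ n) λ v →
    (∃[ i ] ¬ (v i ≈ᶜ 0ᶜ)) ×
    (∀ i → sumᶜ (λ j → ι (M i j) *ᶜ v j) ≈ᶜ μ *ᶜ v i)

  spectralRadius : ∀ {n} → Matrix n → ℝ
  spectralRadius M = sup λ t → ∃[ μ ] IsEigenvalue M μ × t ≈ ∣ μ ∣

  -- Indices start at 0 here, so the exponent (i - 1) / 2 becomes i / 2.
  A : (h : ℕ) → ℝ → Matrix h
  A h r i j =
    if toℕ j ≡ᵇ ℕ.suc (toℕ i) then √ (r ^ toℕ i) else
    if toℕ i ≡ᵇ ℕ.suc (toℕ j) then √ (r ^ toℕ j) else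
    0#

  Λ : ℕ → ℝ → ℝ
  Λ h r = spectralRadius (A h r) ^ 2

  x[_] : ℕ → ℝ → ℝ → ℝ
  x[ k ] p q =
    (p ^ (2 ℕ.* k ∸ 1) * q * Λ (ℕ.suc k) (q ^ 2 * (p ^ 2) ⁻¹)) ⁻¹

  -- For p and q in (0,1) the infimum is attained, so this is the minimum.
  x⋆ : ℝ → ℝ → ℝ
  x⋆ p q = inf λ t → ∃[ k ] 1 ℕ.≤ k × t ≈ x[ k ] p q

  D : ℕ → ℂ → ℂ → ℂ
  D h X Q = P h (Q *ᶜ X) Q *ᶜ (P (ℕ.suc h) X Q) ⁻¹ᶜ

  -- The arguments at which D k is evaluated in the definition of G.
  Xarg : ℕ → ℂ → ℝ → ℝ → ℂ
  Xarg k x p q = ι (q ^ (2 ℕ.* k ∸ 1) * p) *ᶜ x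

  Qarg : ℝ → ℝ → ℂ
  Qarg p q = ι (p ^ 2 * (q ^ 2) ⁻¹)

  G : ℕ → ℂ → ℂ → ℝ → ℝ → ℂ
  G h x y p q =
    x ^ᶜ h *ᶜ y ^ᶜ h *ᶜ ι q ^ᶜ (h ℕ.* h)
      *ᶜ productᶜ {h ∸ 1} (λ i → let k = ℕ.suc (toℕ i) in
           D k (Xarg k x p q) (Qarg p q)) ^ᶜ 2
      *ᶜ D h (Xarg h x p q) (Qarg p q)

  -- No factor D k of G h is evaluated at a zero of its denominator, so that
  -- the value of G h does not depend on the unspecified inverse of zero.
  GDefined : ℕ → ℂ → ℝ → ℝ → Set
  GDefined h x p q = ∀ k → 1 ℕ.≤ k → k ℕ.≤ h →
    ¬ (P (ℕ.suc k) (Xarg k x p q) (Qarg p q) ≈ᶜ 0ᶜ)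

{-# OPTIONS --safe #-}
module Submission where

open import Defs
open import Level using (0ℓ)
open import Axiom.ExcludedMiddle using (ExcludedMiddle)
open import Data.Nat.Base as ℕ using (ℕ)
open import Data.Product.Base using (Σ; _×_; _,_; ∃-syntax)
open import Relation.Unary using (Pred)
open import Algebra.Bundles using (CommutativeRing; RawRing)
open import Data.Product.Base using (∃; proj₁; proj₂)

-- Put r = q²/p² and z = p^(2k-1) q x, and let c n = det (I - √z A n r), the
-- continuant of the weights r^j z. Up to reversing the order of the weights,
-- D k = c k / c (k + 1). At the first X > 0 where one of the continuants
-- c 0, …, c n vanishes, the recurrence shows that it is c n, and then 1/√X is an
-- eigenvalue of A n r; so the continuants are positive for 0 ≤ x < x⋆. By the
-- triangle inequality ∣c k / c (k + 1)∣ is bounded by its value at ∣x∣, and the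
-- recurrence bounds that value in terms of the distance from ∣x∣ to x⋆, hence
-- uniformly in k, on K and for ∣x∣ ≤ x⋆ - ε. Thus ∣G h∣ ≤ W^h s^(h²) with W
-- constant and s < 1 an upper bound of q on K, and the factor s^(h²) wins.

-- The gap between ∣x∣ and x⋆ has to serve twice: positivity of the continuants requires a real
-- point strictly below x⋆, and the bound on a quotient requires that point to lie beyond ∣x∣ by a
-- definite amount. Hence an intermediate radius X at which the real continuants are evaluated. The
-- obstacle to uniformity in k is the scale p^(2k-1) q, which tends to zero; but it multiplies X and
-- ∣x∣ alike, and only X / (X - ∣x∣) enters the estimate. All dependence on (p , q) passes through a
-- margin δ with δ ≤ p and δ ≤ q ≤ 1 - δ, which compactness supplies; k = 1 alone then gives x⋆ ≤
-- δ⁻². Since `sup` and the inverse are unspecified outside their usual domain, each use of them is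
-- accompanied by a proof of nonemptiness and boundedness, or of nonvanishing.

-- Ring solver with integer coefficients.

module CommutativeRingSolver {c ℓ} (R : CommutativeRing c ℓ) where
  open import Data.Nat.Base using (zero; suc)
  import Data.Nat.Properties as ℕ
  open import Data.Maybe.Base using (Maybe; just; nothing)
  open import Relation.Nullary using (yes; no)
  open import Relation.Binary.PropositionalEquality as ≡ using (_≡_)
  open import Algebra.Solver.Ring.AlmostCommutativeRing
  open CommutativeRing R
  open import Algebra.Properties.Ring ring
    using (-‿distribˡ-*; -‿distribʳ-*; -‿involutive; -0#≈0#; -‿+-comm)
  open import Algebra.Properties.Semiring.Mult.TCOptimised semiring
    using (×1-homo-*; ×-homo-+) renaming (_×_ to _·_)
  open import Algebra.Solver.Ring.NaturalCoefficients.Default commutativeSemiring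
    as S using ()
  open import Relation.Binary.Reasoning.Setoid setoid

  private
    -- The coefficient (a , b) stands for the integer a - b. The value has a
    -- separate clause for b = 0 so that (0 , 0) and (1 , 0) denote 0# and 1#
    -- definitionally.
    Coeff : RawRing 0ℓ 0ℓ
    Coeff = record
      { Carrier = ℕ × ℕ
      ; _≈_ = _≡_
      ; _+_ = λ (a , b) (c , d) → a ℕ.+ c , b ℕ.+ d
      ; _*_ = λ (a , b) (c , d) → a ℕ.* c ℕ.+ b ℕ.* d , a ℕ.* d ℕ.+ b ℕ.* c
      ; -_ = λ (a , b) → b , a
      ; 0# = 0 , 0
      ; 1# = 1 , 0
      }

    ⟦_⟧ : ℕ × ℕ → Carrier
    ⟦ a , 0 ⟧ = a · 1#
    ⟦ a , b@(suc _) ⟧ = a · 1# - b · 1#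

    ⟦⟧-minus : ∀ a b → ⟦ a , b ⟧ ≈ a · 1# - b · 1#
    ⟦⟧-minus a zero = sym (trans (+-congˡ -0#≈0#) (+-identityʳ _))
    ⟦⟧-minus a (suc b) = refl

    module C = RawRing Coeff

    +-homo : ∀ x y → ⟦ x C.+ y ⟧ ≈ ⟦ x ⟧ + ⟦ y ⟧
    +-homo (a , b) (c , d) = begin
      ⟦ a ℕ.+ c , b ℕ.+ d ⟧
        ≈⟨ ⟦⟧-minus (a ℕ.+ c) (b ℕ.+ d) ⟩
      (a ℕ.+ c) · 1# - (b ℕ.+ d) · 1#
        ≈⟨ +-cong (×-homo-+ 1# a c) (-‿cong (×-homo-+ 1# b d)) ⟩
      a · 1# + c · 1# - (b · 1# + d · 1#)
        ≈⟨ +-congˡ (sym (-‿+-comm (b · 1#) (d · 1#))) ⟩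
      a · 1# + c · 1# + (- (b · 1#) + - (d · 1#))
        ≈⟨ S.solve 4 (λ a b c d → (a S.:+ c) S.:+ (b S.:+ d) S.:= (a S.:+ b) S.:+ (c S.:+ d)) refl _ _ _ _ ⟩
      (a · 1# - b · 1#) + (c · 1# - d · 1#)
        ≈⟨ +-cong (⟦⟧-minus a b) (⟦⟧-minus c d) ⟨
      ⟦ a , b ⟧ + ⟦ c , d ⟧ ∎

    minus-* : ∀ a b c d → (a - b) * (c - d) ≈ a * c + b * d - (a * d + b * c)
    minus-* a b c d = begin
      (a - b) * (c - d)
        ≈⟨ S.solve 4 (λ a b c d → (a S.:+ b) S.:* (c S.:+ d) S.:=
             (a S.:* c S.:+ b S.:* d) S.:+ (a S.:* d S.:+ b S.:* c)) refl a (- b) c (- d) ⟩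
      a * c + - b * - d + (a * - d + - b * c)
        ≈⟨ +-cong (+-congˡ (trans (sym (-‿distribˡ-* b (- d)))
             (trans (-‿cong (sym (-‿distribʳ-* b d))) (-‿involutive _))))
             (+-cong (sym (-‿distribʳ-* a d)) (sym (-‿distribˡ-* b c))) ⟩
      a * c + b * d + (- (a * d) + - (b * c))
        ≈⟨ +-congˡ (-‿+-comm _ _) ⟩
      a * c + b * d - (a * d + b * c) ∎

    *-homo : ∀ x y → ⟦ x C.* y ⟧ ≈ ⟦ x ⟧ * ⟦ y ⟧
    *-homo (a , b) (c , d) = begin
      ⟦ a ℕ.* c ℕ.+ b ℕ.* d , a ℕ.* d ℕ.+ b ℕ.* c ⟧
        ≈⟨ ⟦⟧-minus (a ℕ.* c ℕ.+ b ℕ.* d) (a ℕ.* d ℕ.+ b ℕ.* c) ⟩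
      (a ℕ.* c ℕ.+ b ℕ.* d) · 1# - (a ℕ.* d ℕ.+ b ℕ.* c) · 1#
        ≈⟨ +-cong (homo a c b d) (-‿cong (homo a d b c)) ⟩
      a · 1# * c · 1# + b · 1# * d · 1# - (a · 1# * d · 1# + b · 1# * c · 1#)
        ≈⟨ minus-* (a · 1#) (b · 1#) (c · 1#) (d · 1#) ⟨
      (a · 1# - b · 1#) * (c · 1# - d · 1#)
        ≈⟨ *-cong (⟦⟧-minus a b) (⟦⟧-minus c d) ⟨
      ⟦ a , b ⟧ * ⟦ c , d ⟧ ∎
      where
      homo : ∀ a c b d →
        (a ℕ.* c ℕ.+ b ℕ.* d) · 1# ≈ a · 1# * c · 1# + b · 1# * d · 1#
      homo a c b d = trans (×-homo-+ 1# (a ℕ.* c) (b ℕ.* d))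
        (+-cong (×1-homo-* a c) (×1-homo-* b d))

    -‿homo : ∀ x → ⟦ C.- x ⟧ ≈ - ⟦ x ⟧
    -‿homo (a , b) = begin
      ⟦ b , a ⟧                ≈⟨ ⟦⟧-minus b a ⟩
      b · 1# - a · 1#          ≈⟨ +-comm _ _ ⟩
      - (a · 1#) + b · 1#      ≈⟨ +-congˡ (-‿involutive _) ⟨
      - (a · 1#) - - (b · 1#)  ≈⟨ -‿+-comm _ _ ⟩
      - (a · 1# - b · 1#)      ≈⟨ -‿cong (⟦⟧-minus a b) ⟨
      - ⟦ a , b ⟧              ∎

    morphism : Coeff -Raw-AlmostCommutative⟶ fromCommutativeRing R
    morphism = record
      { ⟦_⟧ = ⟦_⟧ ; +-homo = +-homo ; *-homo = *-homo ; -‿homo = -‿homo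
      ; 0-homo = refl ; 1-homo = refl }

    -- Different pairs can denote the same integer, so equality is decided by cross-addition; this
    -- is what lets the solver recognise that opposite terms cancel.
    _≟_ : ∀ x y → Maybe (⟦ x ⟧ ≈ ⟦ y ⟧)
    (a , b) ≟ (c , d) with a ℕ.+ d ℕ.≟ c ℕ.+ b
    ... | no _ = nothing
    ... | yes eq = just (begin
      ⟦ a , b ⟧                      ≈⟨ ⟦⟧-minus a b ⟩
      a · 1# - b · 1#                ≈⟨ cancel (a · 1#) (b · 1#) (d · 1#) ⟨
      a · 1# + d · 1# - (b · 1# + d · 1#)  ≈⟨ +-congʳ (×-homo-+ 1# a d) ⟨
      (a ℕ.+ d) · 1# - (b · 1# + d · 1#)   ≈⟨ +-cong (reflexive (≡.cong (_· 1#) eq)) (-‿cong (+-comm _ _)) ⟩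
      (c ℕ.+ b) · 1# - (d · 1# + b · 1#)   ≈⟨ +-congʳ (×-homo-+ 1# c b) ⟩
      c · 1# + b · 1# - (d · 1# + b · 1#)  ≈⟨ cancel (c · 1#) (d · 1#) (b · 1#) ⟩
      c · 1# - d · 1#                ≈⟨ ⟦⟧-minus c d ⟨
      ⟦ c , d ⟧                      ∎)
      where
      cancel : ∀ x y z → x + z - (y + z) ≈ x - y
      cancel x y z = begin
        x + z - (y + z)      ≈⟨ +-congˡ (-‿+-comm y z) ⟨
        x + z + (- y + - z)  ≈⟨ S.solve 4 (λ x z y z′ → x S.:+ z S.:+ (y S.:+ z′) S.:=
                                 x S.:+ y S.:+ (z S.:+ z′)) refl x z (- y) (- z) ⟩
        x - y + (z - z)      ≈⟨ +-congˡ (-‿inverseʳ z) ⟩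
        x - y + 0#           ≈⟨ +-identityʳ _ ⟩
        x - y                ∎

  open import Algebra.Solver.Ring Coeff (fromCommutativeRing R) morphism _≟_ public
    using (Polynomial; solve; _:=_; _:+_; _:*_; _:-_; :-_; _:^_; con)

  :0 :1 : ∀ {n} → Polynomial n
  :0 = con (0 , 0)
  :1 = con (1 , 0)

-- The polynomials P as continuants.

module Continuants {c ℓ} (R : CommutativeRing c ℓ) where
  open import Data.Fin.Base using (toℕ)
  open import Data.Nat.Base using (zero; suc; _∸_; ⌊_/2⌋; s≤s; z≤n)
  import Data.Nat.Properties as ℕ
  open import Relation.Nullary using (yes; no; contradiction)
  open import Relation.Binary.PropositionalEquality as ≡ using (_≡_)
  open CommutativeRing R
  open import Algebra.Properties.Semiring.Exp semiring
  open import Algebra.Properties.CommutativeSemiring.Exp commutativeSemiring using (^-distrib-*)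
  open import Algebra.Properties.Ring ring using (-‿distribˡ-*; -‿distribʳ-*)
  open import Algebra.Properties.Semiring.Sum semiring
    using (sum; sum-cong-≋; ∑-distrib-+; *-distribˡ-sum; sum-replicate-zero)
  open CommutativeRingSolver R
  open Polynomials rawRing
  open import Relation.Binary.Reasoning.Setoid setoid

  -- Summands indexed by ℕ allow index shifts and changes of range without casts between the types
  -- `Fin n`.
  Σ< : ℕ → (ℕ → Carrier) → Carrier
  Σ< n f = sum {n} λ i → f (toℕ i)

  Σ<-cong : ∀ n {f g} → (∀ i → f i ≈ g i) → Σ< n f ≈ Σ< n g
  Σ<-cong n f≈g = sum-cong-≋ {n} λ i → f≈g (toℕ i)

  Σ<-zero : ∀ n {f} → (∀ i → f i ≈ 0#) → Σ< n f ≈ 0#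
  Σ<-zero n f≈0 = trans (sum-cong-≋ {n} λ i → f≈0 (toℕ i)) (sum-replicate-zero n)

  Σ<-extend : ∀ {m n} {f} → m ℕ.≤ n → (∀ i → m ℕ.≤ i → f i ≈ 0#) → Σ< n f ≈ Σ< m f
  Σ<-extend {n = n} z≤n f≈0 = Σ<-zero n λ i → f≈0 i z≤n
  Σ<-extend (s≤s m≤n) f≈0 = +-congˡ (Σ<-extend m≤n λ i m≤i → f≈0 (suc i) (s≤s m≤i))

  Q^-shift : ∀ m Q → Q ^ (m ℕ.* (m ∸ 1)) * (Q ^ m * Q ^ m) ≈ Q ^ (suc m ℕ.* m)
  Q^-shift m Q = begin
    Q ^ (m ℕ.* (m ∸ 1)) * (Q ^ m * Q ^ m)
      ≈⟨ *-congˡ (^-homo-* Q m m) ⟨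
    Q ^ (m ℕ.* (m ∸ 1)) * Q ^ (m ℕ.+ m)
      ≈⟨ ^-homo-* Q (m ℕ.* (m ∸ 1)) (m ℕ.+ m) ⟨
    Q ^ (m ℕ.* (m ∸ 1) ℕ.+ (m ℕ.+ m))
      ≡⟨ ≡.cong (Q ^_) (eq m) ⟩
    Q ^ (suc m ℕ.* m) ∎
    where
    eq : ∀ m → m ℕ.* (m ∸ 1) ℕ.+ (m ℕ.+ m) ≡ suc m ℕ.* m
    eq zero = ≡.refl
    eq m@(suc k) = ≡.trans (≡.sym (ℕ.+-assoc (m ℕ.* k) m m))
      (≡.trans (≡.cong (ℕ._+ m) (≡.trans (ℕ.+-comm (m ℕ.* k) m) (≡.sym (ℕ.*-suc m k))))
      (ℕ.+-comm (m ℕ.* m) m))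

  gaussian-zero : ∀ {n m} Q → n ℕ.< m → gaussian n m Q ≈ 0#
  gaussian-zero {zero} Q (s≤s n<m) = refl
  gaussian-zero {suc n} {suc m} Q (s≤s n<m) = begin
    gaussian n m Q + Q ^ suc m * gaussian n (suc m) Q
      ≈⟨ +-cong (gaussian-zero Q n<m) (*-congˡ (gaussian-zero Q (ℕ.m<n⇒m<1+n n<m))) ⟩
    0# + Q ^ suc m * 0#  ≈⟨ trans (+-identityˡ _) (zeroʳ _) ⟩
    0# ∎

  term : ℕ → Carrier → Carrier → ℕ → Carrier
  term h X Q m = (- X) ^ m * Q ^ (m ℕ.* (m ∸ 1)) * gaussian (h ∸ m) m Q

  term-zero : ∀ h X Q m → suc ⌊ h /2⌋ ℕ.≤ m → term h X Q m ≈ 0#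
  term-zero h X Q m h/2<m = trans (*-congˡ (gaussian-zero Q (lemma h m h/2<m))) (zeroʳ _)
    where
    lemma : ∀ h m → ⌊ h /2⌋ ℕ.< m → h ∸ m ℕ.< m
    lemma zero (suc m) _ = s≤s z≤n
    lemma (suc zero) (suc zero) _ = s≤s z≤n
    lemma (suc zero) (suc (suc m)) _ = s≤s z≤n
    lemma (suc (suc h)) (suc m) (s≤s h/2<m) with m ℕ.≤? h
    ... | yes m≤h = ℕ.≤-trans (ℕ.≤-reflexive (≡.cong suc (ℕ.+-∸-assoc 1 m≤h))) (s≤s (lemma h m h/2<m))
    ... | no m≰h = ℕ.≤-trans (s≤s (ℕ.≤-reflexive (ℕ.m≤n⇒m∸n≡0 (ℕ.≰⇒> m≰h)))) (s≤s z≤n)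

  -- The three polynomials in the recurrence have ranges of different lengths, depending on the
  -- parity of h; padding with vanishing Gaussian binomials gives ranges that can be added termwise.
  P-as-Σ< : ∀ {h} N X Q → h ℕ.≤ N → P h X Q ≈ Σ< (suc N) (term h X Q)
  P-as-Σ< {h} N X Q h≤N = sym (Σ<-extend
    (s≤s (ℕ.≤-trans (ℕ.⌊n/2⌋≤n h) h≤N)) (term-zero h X Q))

  -- The q-Pascal rule splits the binomial in two. The part with factor Q^(m+1) turns X^(m+1) into
  -- (QX)^(m+1); in the other part m(m-1) + 2m = (m+1)m supplies the Q^(2m) that turns X^m into
  -- (Q²X)^m.
  term-rec : ∀ h X Q m →
    term (2 ℕ.+ h) X Q (suc m) ≈
    term (suc h) (Q * X) Q (suc m) + - X * term h (Q * (Q * X)) Q m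
  term-rec h X Q m = begin
    - X * a * Q ^ (suc m ℕ.* m) * gaussian (suc h ∸ m) (suc m) Q
      ≈⟨ *-congˡ (pascal h m) ⟩
    - X * a * Q ^ (suc m ℕ.* m) * (g₁ + Q ^ suc m * g₂)
      ≈⟨ distribˡ _ _ _ ⟩
    - X * a * Q ^ (suc m ℕ.* m) * g₁ + - X * a * Q ^ (suc m ℕ.* m) * (Q ^ suc m * g₂)
      ≈⟨ +-comm _ _ ⟩
    - X * a * Q ^ (suc m ℕ.* m) * (Q ^ suc m * g₂) + - X * a * Q ^ (suc m ℕ.* m) * g₁
      ≈⟨ +-cong left right ⟩
    term (suc h) (Q * X) Q (suc m) + - X * term h (Q * (Q * X)) Q m ∎
    where
    a = (- X) ^ m
    g₁ = gaussian (h ∸ m) m Q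
    g₂ = gaussian (h ∸ m) (suc m) Q
    pascal : ∀ h m → gaussian (suc h ∸ m) (suc m) Q ≈
      gaussian (h ∸ m) m Q + Q ^ suc m * gaussian (h ∸ m) (suc m) Q
    pascal h m with m ℕ.≤? h
    ... | yes m≤h rewrite ℕ.+-∸-assoc 1 m≤h = refl
    pascal h zero | no m≰h = contradiction z≤n m≰h
    -- Here both differences truncate to zero, and all the binomials involved have positive lower
    -- index, so both sides vanish.
    pascal h (suc m) | no m≰h
      rewrite ℕ.m≤n⇒m∸n≡0 (ℕ.≤-pred (ℕ.≰⇒> m≰h)) | ℕ.m≤n⇒m∸n≡0 (ℕ.<⇒≤ (ℕ.≰⇒> m≰h)) =
      sym (trans (+-identityˡ _) (zeroʳ _))
    neg-^ : ∀ Y n → (- (Q * Y)) ^ n ≈ Q ^ n * (- Y) ^ n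
    neg-^ Y n = trans (^-congˡ n (-‿distribʳ-* Q Y)) (^-distrib-* Q (- Y) n)
    left : - X * a * Q ^ (suc m ℕ.* m) * (Q ^ suc m * g₂) ≈ term (suc h) (Q * X) Q (suc m)
    left = begin
      - X * a * Q ^ (suc m ℕ.* m) * (Q ^ suc m * g₂)
        ≈⟨ solve 4 (λ x y z w → x :* y :* (z :* w) := z :* x :* y :* w) refl
             (- X * a) (Q ^ (suc m ℕ.* m)) (Q ^ suc m) g₂ ⟩
      Q ^ suc m * (- X * a) * Q ^ (suc m ℕ.* m) * g₂
        ≈⟨ *-congʳ (*-congʳ (neg-^ X (suc m))) ⟨
      term (suc h) (Q * X) Q (suc m) ∎
    right : - X * a * Q ^ (suc m ℕ.* m) * g₁ ≈ - X * term h (Q * (Q * X)) Q m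
    right = begin
      - X * a * Q ^ (suc m ℕ.* m) * g₁
        ≈⟨ *-congʳ (*-congˡ (Q^-shift m Q)) ⟨
      - X * a * (Q ^ (m ℕ.* (m ∸ 1)) * (Q ^ m * Q ^ m)) * g₁
        ≈⟨ solve 5 (λ x a y z w → x :* a :* (y :* (z :* z)) :* w := x :* (z :* (z :* a) :* y :* w))
             refl (- X) a (Q ^ (m ℕ.* (m ∸ 1))) (Q ^ m) g₁ ⟩
      - X * (Q ^ m * (Q ^ m * a) * Q ^ (m ℕ.* (m ∸ 1)) * g₁)
        ≈⟨ *-congˡ (*-congʳ (*-congʳ (trans (neg-^ (Q * X) m) (*-congˡ (neg-^ X m))))) ⟨
      - X * term h (Q * (Q * X)) Q m ∎

  term-0 : ∀ h X Q → term h X Q 0 ≈ 1#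
  term-0 h X Q = trans (*-identityʳ _) (*-identityʳ _)

  -- The terms with m = 0 equal 1 on both sides, and `term-rec` handles the others. As a determinant
  -- expansion this removes the first row, which multiplies the remaining weights' starting value X
  -- by Q.
  P-rec : ∀ h X Q → P (2 ℕ.+ h) X Q ≈ P (suc h) (Q * X) Q - X * P h (Q * (Q * X)) Q
  P-rec h X Q = begin
    P (2 ℕ.+ h) X Q
      ≈⟨ P-as-Σ< (2 ℕ.+ h) X Q ℕ.≤-refl ⟩
    term (2 ℕ.+ h) X Q 0 + Σ< (2 ℕ.+ h) (λ m → term (2 ℕ.+ h) X Q (suc m))
      ≈⟨ +-cong (trans (term-0 (2 ℕ.+ h) X Q) (sym (term-0 (suc h) (Q * X) Q)))
          (Σ<-cong (2 ℕ.+ h) (term-rec h X Q)) ⟩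
    term (suc h) (Q * X) Q 0 + Σ< (2 ℕ.+ h) (λ m →
      term (suc h) (Q * X) Q (suc m) + - X * term h (Q * (Q * X)) Q m)
      ≈⟨ +-congˡ (∑-distrib-+ {2 ℕ.+ h} (λ i → term (suc h) (Q * X) Q (suc (toℕ i)))
             (λ i → - X * term h (Q * (Q * X)) Q (toℕ i))) ⟩
    term (suc h) (Q * X) Q 0 + (Σ< (2 ℕ.+ h) (λ m → term (suc h) (Q * X) Q (suc m)) +
      Σ< (2 ℕ.+ h) (λ m → - X * term h (Q * (Q * X)) Q m))
      ≈⟨ +-assoc _ _ _ ⟨
    Σ< (3 ℕ.+ h) (term (suc h) (Q * X) Q) +
      Σ< (2 ℕ.+ h) (λ m → - X * term h (Q * (Q * X)) Q m)
      ≈⟨ +-cong (P-as-Σ< (2 ℕ.+ h) (Q * X) Q (ℕ.n≤1+n _))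
           (*-distribˡ-sum {2 ℕ.+ h} (- X) (λ i → term h (Q * (Q * X)) Q (toℕ i))) ⟨
    P (suc h) (Q * X) Q + - X * Σ< (2 ℕ.+ h) (term h (Q * (Q * X)) Q)
      ≈⟨ +-congˡ (*-congˡ (P-as-Σ< (suc h) (Q * (Q * X)) Q (ℕ.n≤1+n _))) ⟨
    P (suc h) (Q * X) Q + - X * P h (Q * (Q * X)) Q
      ≈⟨ +-congˡ (-‿distribˡ-* X _) ⟨
    P (suc h) (Q * X) Q - X * P h (Q * (Q * X)) Q ∎

  P-congˡ : ∀ h {X Y} Q → X ≈ Y → P h X Q ≈ P h Y Q
  P-congˡ h {X} {Y} Q X≈Y = Σ<-cong (suc ⌊ h /2⌋) {term h X Q} {term h Y Q}
    λ m → *-congʳ (*-congʳ (^-congˡ m (-‿cong X≈Y)))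

  -- det (I - T) for the i × i tridiagonal matrix T with zero diagonal and
  -- products w 0, w 1, … of opposite off-diagonal entries.
  continuant : (ℕ → Carrier) → ℕ → Carrier
  continuant w zero = 1#
  continuant w (suc zero) = 1#
  continuant w (suc (suc i)) = continuant w (suc i) - w i * continuant w i

  -- P expands its continuant from the first row, the definition of
  -- `continuant` from the last one; P-continuant reverses the order of the weights.
  module Reversal {Q r : Carrier} (Qr≈1 : Q * r ≈ 1#) (z : Carrier) where
    private
      X : ℕ → Carrier
      X i = r ^ i * (Q * (Q * z))

    shift : ∀ i → Q * X (suc i) ≈ X i
    shift i = begin
      Q * (r * r ^ i * (Q * (Q * z)))
        ≈⟨ solve 4 (λ Q r y z → Q :* (r :* y :* z) := Q :* r :* (y :* z)) refl Q r (r ^ i) (Q * (Q * z)) ⟩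
      Q * r * X i  ≈⟨ *-congʳ Qr≈1 ⟩
      1# * X i     ≈⟨ *-identityˡ _ ⟩
      X i ∎

    shift₂ : ∀ i → X (2 ℕ.+ i) ≈ r ^ i * z
    shift₂ i = begin
      r * (r * r ^ i) * (Q * (Q * z))
        ≈⟨ solve 4 (λ Q r y z → r :* (r :* y) :* (Q :* (Q :* z)) := Q :* r :* (Q :* r :* (y :* z)))
             refl Q r (r ^ i) z ⟩
      Q * r * (Q * r * (r ^ i * z))  ≈⟨ *-cong Qr≈1 (*-congʳ Qr≈1) ⟩
      1# * (1# * (r ^ i * z))        ≈⟨ trans (*-identityˡ _) (*-identityˡ _) ⟩
      r ^ i * z ∎

    -- Since Q = 1/r, the argument is r^(i-2) z, the last weight of the continuant of size i;
    -- writing it with two factors Q makes it meaningful for i < 2 as well. Each step of `P-rec`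
    -- strips this last weight, and multiplication by Q moves on to the weight before it.
    P-continuant : ∀ i → P i (r ^ i * (Q * (Q * z))) Q ≈ continuant (λ j → r ^ j * z) i
    P-continuant zero = trans (+-identityʳ _) (trans (*-identityʳ _) (*-identityʳ _))
    P-continuant (suc zero) = trans (+-identityʳ _) (trans (*-identityʳ _) (*-identityʳ _))
    P-continuant (suc (suc i)) = begin
      P (2 ℕ.+ i) (X (2 ℕ.+ i)) Q
        ≈⟨ P-rec i (X (2 ℕ.+ i)) Q ⟩
      P (suc i) (Q * X (2 ℕ.+ i)) Q - X (2 ℕ.+ i) * P i (Q * (Q * X (2 ℕ.+ i))) Q
        ≈⟨ +-cong (P-congˡ (suc i) Q (shift (suc i)))
             (-‿cong (*-cong (shift₂ i) (P-congˡ i Q (trans (*-congˡ (shift (suc i))) (shift i))))) ⟩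
      P (suc i) (X (suc i)) Q - r ^ i * z * P i (X i) Q
        ≈⟨ +-cong (P-continuant (suc i)) (-‿cong (*-congˡ (P-continuant i))) ⟩
      continuant (λ j → r ^ j * z) (2 ℕ.+ i) ∎

    -- When X is the last weight r^j z, the two parts of `D (suc j)` are consecutive continuants of
    -- one weight sequence: the Q in the numerator's argument drops the last weight.
    denominator : ∀ j {X} → X ≈ r ^ j * z →
      P (2 ℕ.+ j) X Q ≈ continuant (λ j → r ^ j * z) (2 ℕ.+ j)
    denominator j X≈ = trans (P-congˡ (2 ℕ.+ j) Q (trans X≈ (sym (shift₂ j)))) (P-continuant (2 ℕ.+ j))

    numerator : ∀ j {X} → X ≈ r ^ j * z →
      P (suc j) (Q * X) Q ≈ continuant (λ j → r ^ j * z) (suc j)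
    numerator j X≈ = trans (P-congˡ (suc j) Q (trans (*-congˡ (trans X≈ (sym (shift₂ j)))) (shift (suc j))))
      (P-continuant (suc j))

-- Order, powers, square roots and infima in a complete ordered field.

module RealField (em : ExcludedMiddle 0ℓ) (𝓡 : CompleteOrderedField) where
  open import Data.Empty using (⊥-elim)
  open import Data.Nat.Base using (zero; suc)
  import Data.Nat.Properties as ℕ
  open import Data.Sum.Base using (_⊎_; inj₁; inj₂)
  open import Relation.Binary.Bundles using (Poset)
  open import Relation.Binary.Structures using (IsTotalOrder)
  open import Relation.Nullary using (¬_; yes; no)

  open CompleteOrderedField 𝓡
  open CommutativeRingSolver commutativeRing
  open import Algebra.Properties.Semiring.Exp semiring
  open import Algebra.Properties.Ring ring using (-0#≈0#; -‿involutive)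

  open IsTotalOrder isTotalOrder public
    using (isPartialOrder; total; ≤-respˡ-≈; ≤-respʳ-≈)
    renaming (refl to ≤-refl; trans to ≤-trans; antisym to ≤-antisym; reflexive to ≤-reflexive)

  poset : Poset 0ℓ 0ℓ 0ℓ
  poset = record { isPartialOrder = isPartialOrder }

  open import Relation.Binary.Properties.Poset poset public
    using (<⇒≱; <-respˡ-≈; <-respʳ-≈)
  import Relation.Binary.Construct.NonStrictToStrict _≈_ _≤_ as Strict
  open import Relation.Binary.Reasoning.PartialOrder poset

  private variable x y z u v : Carrier

  <⇒≤ : x < y → x ≤ y
  <⇒≤ = proj₁

  <-≤-trans : x < y → y ≤ z → x < z
  <-≤-trans = Strict.<-≤-trans sym ≤-trans ≤-antisym ≤-respʳ-≈

  ≤-<-trans : x ≤ y → y < z → x < z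
  ≤-<-trans = Strict.≤-<-trans ≤-trans ≤-antisym ≤-respˡ-≈

  ≤-or-> : ∀ x y → x ≤ y ⊎ y < x
  ≤-or-> x y with total x y
  ... | inj₁ x≤y = inj₁ x≤y
  ... | inj₂ y≤x with em {x ≈ y}
  ...   | yes x≈y = inj₁ (≤-reflexive x≈y)
  ...   | no x≉y = inj₂ (y≤x , λ y≈x → x≉y (sym y≈x))

  ≮⇒≥ : ¬ (x < y) → y ≤ x
  ≮⇒≥ {x} {y} x≮y with ≤-or-> y x
  ... | inj₁ y≤x = y≤x
  ... | inj₂ x<y = ⊥-elim (x≮y x<y)

  ≤-by : ∀ d → 0# ≤ d → x + d ≈ y → x ≤ y
  ≤-by {x} {y} d 0≤d x+d≈y = begin
    x       ≈⟨ +-identityˡ x ⟨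
    0# + x  ≤⟨ +-monoˡ-≤ x 0≤d ⟩
    d + x   ≈⟨ +-comm d x ⟩
    x + d   ≈⟨ x+d≈y ⟩
    y       ∎

  x≤y⇒0≤y-x : x ≤ y → 0# ≤ y - x
  x≤y⇒0≤y-x {x} {y} x≤y = begin
    0#     ≈⟨ -‿inverseʳ x ⟨
    x - x  ≤⟨ +-monoˡ-≤ (- x) x≤y ⟩
    y - x  ∎

  0≤y-x⇒x≤y : 0# ≤ y - x → x ≤ y
  0≤y-x⇒x≤y {y} {x} 0≤y-x = ≤-by (y - x) 0≤y-x
    (solve 2 (λ x y → x :+ (y :- x) := y) refl x y)

  x<y⇒0<y-x : x < y → 0# < y - x
  x<y⇒0<y-x {x} {y} (x≤y , x≉y) = x≤y⇒0≤y-x x≤y , λ 0≈y-x → x≉y (begin-equality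
    x            ≈⟨ +-identityʳ x ⟨
    x + 0#       ≈⟨ +-congˡ 0≈y-x ⟩
    x + (y - x)  ≈⟨ solve 2 (λ x y → x :+ (y :- x) := y) refl x y ⟩
    y            ∎)

  0<y-x⇒x<y : 0# < y - x → x < y
  0<y-x⇒x<y {y} {x} (0≤y-x , 0≉y-x) = 0≤y-x⇒x≤y 0≤y-x , λ x≈y →
    0≉y-x (sym (trans (+-congʳ (sym x≈y)) (-‿inverseʳ x)))

  +-mono-≤ : x ≤ y → u ≤ v → x + u ≤ y + v
  +-mono-≤ {x} {y} {u} {v} x≤y u≤v = begin
    x + u  ≤⟨ +-monoˡ-≤ u x≤y ⟩
    y + u  ≈⟨ +-comm y u ⟩
    u + y  ≤⟨ +-monoˡ-≤ y u≤v ⟩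
    v + y  ≈⟨ +-comm v y ⟩
    y + v  ∎

  +-nonneg : 0# ≤ x → 0# ≤ y → 0# ≤ x + y
  +-nonneg 0≤x 0≤y = ≤-trans (≤-reflexive (sym (+-identityʳ 0#))) (+-mono-≤ 0≤x 0≤y)

  +-pos : 0# < x → 0# ≤ y → 0# < x + y
  +-pos {x} {y} 0<x 0≤y = <-≤-trans 0<x (≤-by y 0≤y refl)

  -‿mono-≤ : x ≤ y → - y ≤ - x
  -‿mono-≤ {x} {y} x≤y = ≤-by (y - x) (x≤y⇒0≤y-x x≤y)
    (solve 2 (λ x y → :- y :+ (y :- x) := :- x) refl x y)

  square-nonneg : ∀ x → 0# ≤ x * x
  square-nonneg x with total 0# x
  ... | inj₁ 0≤x = *-nonneg 0≤x 0≤x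
  ... | inj₂ x≤0 = ≤-respʳ-≈ (solve 1 (λ x → :- x :* :- x := x :* x) refl x)
          (*-nonneg 0≤-x 0≤-x)
    where
    0≤-x : 0# ≤ - x
    0≤-x = ≤-respˡ-≈ -0#≈0# (-‿mono-≤ x≤0)

  0<1 : 0# < 1#
  0<1 = ≤-respʳ-≈ (*-identityʳ 1#) (square-nonneg 1#) , 0≉1

  *-monoʳ-≤ : 0# ≤ z → x ≤ y → x * z ≤ y * z
  *-monoʳ-≤ {z} {x} {y} 0≤z x≤y = ≤-by ((y - x) * z) (*-nonneg (x≤y⇒0≤y-x x≤y) 0≤z)
    (solve 3 (λ x y z → x :* z :+ (y :- x) :* z := y :* z) refl x y z)

  *-monoˡ-≤ : 0# ≤ z → x ≤ y → z * x ≤ z * y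
  *-monoˡ-≤ {z} {x} {y} 0≤z x≤y = begin
    z * x  ≈⟨ *-comm z x ⟩
    x * z  ≤⟨ *-monoʳ-≤ 0≤z x≤y ⟩
    y * z  ≈⟨ *-comm y z ⟩
    z * y  ∎

  *-mono-≤ : 0# ≤ x → 0# ≤ u → x ≤ y → u ≤ v → x * u ≤ y * v
  *-mono-≤ 0≤x 0≤u x≤y u≤v =
    ≤-trans (*-monoʳ-≤ 0≤u x≤y) (*-monoˡ-≤ (≤-trans 0≤x x≤y) u≤v)

  *-zero-cancelˡ : ¬ x ≈ 0# → x * y ≈ 0# → y ≈ 0#
  *-zero-cancelˡ {x} {y} x≉0 xy≈0 = begin-equality
    y                ≈⟨ *-identityˡ y ⟨
    1# * y           ≈⟨ *-congʳ (⁻¹-inverseʳ x≉0) ⟨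
    x * x ⁻¹ * y     ≈⟨ solve 3 (λ x w y → x :* w :* y := w :* (x :* y)) refl x (x ⁻¹) y ⟩
    x ⁻¹ * (x * y)   ≈⟨ *-congˡ xy≈0 ⟩
    x ⁻¹ * 0#        ≈⟨ zeroʳ _ ⟩
    0#               ∎

  >⇒≉0 : 0# < x → ¬ x ≈ 0#
  >⇒≉0 (_ , 0≉x) x≈0 = 0≉x (sym x≈0)

  *-pos : 0# < x → 0# < y → 0# < x * y
  *-pos 0<x 0<y = *-nonneg (<⇒≤ 0<x) (<⇒≤ 0<y) , λ 0≈xy →
    >⇒≉0 0<y (*-zero-cancelˡ (>⇒≉0 0<x) (sym 0≈xy))

  *-cancelʳ-≤ : 0# < z → x * z ≤ y * z → x ≤ y
  *-cancelʳ-≤ {z} {x} {y} 0<z xz≤yz with ≤-or-> x y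
  ... | inj₁ x≤y = x≤y
  ... | inj₂ y<x = ⊥-elim (<⇒≱ (0<y-x⇒x<y (<-respʳ-≈
        (solve 3 (λ x y z → (x :- y) :* z := x :* z :- y :* z) refl x y z)
        (*-pos (x<y⇒0<y-x y<x) 0<z))) xz≤yz)

  ⁻¹-inverseˡ : ¬ x ≈ 0# → x ⁻¹ * x ≈ 1#
  ⁻¹-inverseˡ x≉0 = trans (*-comm _ _) (⁻¹-inverseʳ x≉0)

  ⁻¹-pos : 0# < x → 0# < x ⁻¹
  ⁻¹-pos {x} 0<x with ≤-or-> (x ⁻¹) 0#
  ... | inj₂ 0<x⁻¹ = 0<x⁻¹
  ... | inj₁ x⁻¹≤0 = ⊥-elim (<⇒≱ 0<1 (begin
    1#        ≈⟨ ⁻¹-inverseˡ (>⇒≉0 0<x) ⟨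
    x ⁻¹ * x  ≤⟨ *-monoʳ-≤ (<⇒≤ 0<x) x⁻¹≤0 ⟩
    0# * x    ≈⟨ zeroˡ x ⟩
    0#        ∎))

  ^-pos : 0# < x → ∀ n → 0# < x ^ n
  ^-pos 0<x zero = 0<1
  ^-pos 0<x (suc n) = *-pos 0<x (^-pos 0<x n)

  ^-nonneg : 0# ≤ x → ∀ n → 0# ≤ x ^ n
  ^-nonneg 0≤x zero = <⇒≤ 0<1
  ^-nonneg 0≤x (suc n) = *-nonneg 0≤x (^-nonneg 0≤x n)

  ^-monoˡ-≤ : 0# ≤ x → x ≤ y → ∀ n → x ^ n ≤ y ^ n
  ^-monoˡ-≤ 0≤x x≤y zero = ≤-refl
  ^-monoˡ-≤ 0≤x x≤y (suc n) = *-mono-≤ 0≤x (^-nonneg 0≤x n) x≤y (^-monoˡ-≤ 0≤x x≤y n)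

  ^-≤1 : 0# ≤ x → x ≤ 1# → ∀ n → x ^ n ≤ 1#
  ^-≤1 0≤x x≤1 zero = ≤-refl
  ^-≤1 0≤x x≤1 (suc n) = ≤-respʳ-≈ (*-identityʳ 1#)
    (*-mono-≤ 0≤x (^-nonneg 0≤x n) x≤1 (^-≤1 0≤x x≤1 n))

  ^-antitone : 0# ≤ x → x ≤ 1# → ∀ {m n} → m ℕ.≤ n → x ^ n ≤ x ^ m
  ^-antitone {x} 0≤x x≤1 {m} {n} m≤n = begin
    x ^ n                    ≡⟨ ≡.cong (x ^_) (ℕ.m+[n∸m]≡n m≤n) ⟨
    x ^ (m ℕ.+ (n ℕ.∸ m))    ≈⟨ ^-homo-* x m (n ℕ.∸ m) ⟩
    x ^ m * x ^ (n ℕ.∸ m)    ≤⟨ *-monoˡ-≤ (^-nonneg 0≤x m) (^-≤1 0≤x x≤1 (n ℕ.∸ m)) ⟩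
    x ^ m * 1#               ≈⟨ *-identityʳ _ ⟩
    x ^ m                    ∎
    where import Relation.Binary.PropositionalEquality as ≡

  -- Suppose every power of b = s⁻¹ were below W; their supremum β would satisfy β ≤ s β < β.
  power-below : ∀ {s} W → 0# < s → s < 1# → ∃[ N ] W * s ^ N ≤ 1#
  power-below {s} W 0<s s<1 with em {∃[ N ] W * s ^ N ≤ 1#}
  ... | yes p = p
  ... | no ¬p = ⊥-elim (<⇒≱ (0<y-x⇒x<y (<-respʳ-≈
          (solve 2 (λ β s → β :* (:1 :- s) := β :- β :* s) refl β s)
          (*-pos 0<β (x<y⇒0<y-x s<1)))) β≤βs)
    where
    b = s ⁻¹
    b^s^ : ∀ n → b ^ n * s ^ n ≈ 1#
    b^s^ zero = *-identityʳ 1#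
    b^s^ (suc n) = begin-equality
      b * b ^ n * (s * s ^ n)
        ≈⟨ solve 4 (λ b s x y → b :* x :* (s :* y) := (b :* s) :* (x :* y)) refl b s (b ^ n) (s ^ n) ⟩
      b * s * (b ^ n * s ^ n)  ≈⟨ *-cong (⁻¹-inverseˡ (>⇒≉0 0<s)) (b^s^ n) ⟩
      1# * 1#                  ≈⟨ *-identityʳ 1# ⟩
      1#                       ∎
    S : Pred Carrier 0ℓ
    S t = ∃[ n ] t ≈ b ^ n
    bounded : IsUpperBound S W
    bounded {t} (n , t≈b^n) with ≤-or-> (W * s ^ n) 1#
    ... | inj₁ Ws^n≤1 = ⊥-elim (¬p (n , Ws^n≤1))
    ... | inj₂ 1<Ws^n = ≤-respˡ-≈ (sym t≈b^n)
            (*-cancelʳ-≤ (^-pos 0<s n) (≤-respˡ-≈ (sym (b^s^ n)) (<⇒≤ 1<Ws^n)))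
    β = sup S
    upper : ∀ n → b ^ n ≤ β
    upper n = sup-upper (1# , 0 , refl) (W , bounded) (n , refl)
    0<β : 0# < β
    0<β = <-≤-trans 0<1 (upper 0)
    β≤βs : β ≤ β * s
    β≤βs = sup-least (1# , 0 , refl) λ {t} (n , t≈b^n) → begin
      t                ≈⟨ t≈b^n ⟩
      b ^ n            ≈⟨ *-identityˡ _ ⟨
      1# * b ^ n       ≈⟨ *-congʳ (⁻¹-inverseˡ (>⇒≉0 0<s)) ⟨
      b * s * b ^ n    ≈⟨ solve 3 (λ b s x → b :* s :* x := b :* x :* s) refl b s (b ^ n) ⟩
      b ^ suc n * s    ≤⟨ *-monoʳ-≤ (<⇒≤ 0<s) (upper (suc n)) ⟩
      β * s            ∎

  square-cancel-≤ : 0# ≤ y → x * x ≤ y * y → x ≤ y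
  square-cancel-≤ {y} {x} 0≤y xx≤yy with ≤-or-> x y
  ... | inj₁ x≤y = x≤y
  ... | inj₂ y<x = ⊥-elim (<⇒≱ (0<y-x⇒x<y (<-respʳ-≈
        (solve 2 (λ x y → (x :- y) :* (x :+ y) := x :* x :- y :* y) refl x y)
        (*-pos (x<y⇒0<y-x y<x) (+-pos (≤-<-trans 0≤y y<x) 0≤y)))) xx≤yy)

  square-cancel : 0# ≤ x → 0# ≤ y → x * x ≈ y * y → x ≈ y
  square-cancel 0≤x 0≤y xx≈yy = ≤-antisym
    (square-cancel-≤ 0≤y (≤-reflexive xx≈yy)) (square-cancel-≤ 0≤x (≤-reflexive (sym xx≈yy)))

  module _ {a} (0≤a : 0# ≤ a) where
    private
      S : Pred Carrier 0ℓ
      S t = t * t ≤ a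
      S-0 : S 0#
      S-0 = ≤-respˡ-≈ (sym (zeroˡ 0#)) 0≤a
      S-bounded : IsUpperBound S (a + 1#)
      S-bounded {t} tt≤a = square-cancel-≤ (+-nonneg 0≤a (<⇒≤ 0<1)) (≤-trans tt≤a
        (≤-by (a * a + a + 1#) (+-nonneg (+-nonneg (*-nonneg 0≤a 0≤a) 0≤a) (<⇒≤ 0<1))
          (solve 1 (λ a → a :+ (a :* a :+ a :+ :1) := (a :+ :1) :* (a :+ :1)) refl a)))
      upper : IsUpperBound S (√ a)
      upper = sup-upper (0# , S-0) (a + 1# , S-bounded)

    √-nonneg : 0# ≤ √ a
    √-nonneg = upper S-0

    private
      s = √ a

      fraction : ∀ {d m} → 0# ≤ d → 0# < m → ∃[ δ ] 0# ≤ δ × δ * m ≈ d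
      fraction {d} {m} 0≤d 0<m = d * m ⁻¹ , *-nonneg 0≤d (<⇒≤ (⁻¹-pos 0<m)) ,
        trans (*-assoc _ _ _) (trans (*-congˡ (⁻¹-inverseˡ (>⇒≉0 0<m))) (*-identityʳ d))

      pos-factor : 0# ≤ u → 0# < u * v → 0# < u
      pos-factor {u} {v} 0≤u (_ , 0≉uv) = 0≤u , λ 0≈u →
        0≉uv (sym (trans (*-congʳ (sym 0≈u)) (zeroˡ v)))

      -- (s + δ)² ≤ s² + δ m for m = 2s + 1 + d, because δ ≤ 1
      not-below : ¬ (s * s < a)
      not-below ss<a = go (fraction (<⇒≤ 0<d) 0<m)
        where
        d = a - s * s
        m = (d + (s + s)) + 1#
        0<d = x<y⇒0<y-x ss<a
        0≤d+2s = +-nonneg (<⇒≤ 0<d) (+-nonneg √-nonneg √-nonneg)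
        0<m : 0# < m
        0<m = <-respʳ-≈ (+-comm _ _) (+-pos 0<1 0≤d+2s)
        go : ¬ (∃[ δ ] 0# ≤ δ × δ * m ≈ d)
        go (δ , 0≤δ , δm≈d) = <⇒≱ 0<δ (≤-by (s - (s + δ)) (x≤y⇒0≤y-x (upper in-S))
            (solve 2 (λ s δ → δ :+ (s :- (s :+ δ)) := :0) refl s δ))
          where
          0<δ = pos-factor 0≤δ (<-respʳ-≈ (sym δm≈d) 0<d)
          δ≤1 : δ ≤ 1#
          δ≤1 = *-cancelʳ-≤ 0<m (begin
            δ * m   ≈⟨ δm≈d ⟩
            d       ≤⟨ ≤-by ((s + s) + 1#) (+-nonneg (+-nonneg √-nonneg √-nonneg) (<⇒≤ 0<1))
                        (sym (+-assoc _ _ _)) ⟩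
            m       ≈⟨ *-identityˡ m ⟨
            1# * m  ∎)
          in-S : S (s + δ)
          in-S = ≤-by (δ * d + δ * (1# - δ))
            (+-nonneg (*-nonneg 0≤δ (<⇒≤ 0<d)) (*-nonneg 0≤δ (x≤y⇒0≤y-x δ≤1))) (begin-equality
              (s + δ) * (s + δ) + (δ * d + δ * (1# - δ))
                ≈⟨ solve 3 (λ s δ d → (s :+ δ) :* (s :+ δ) :+ (δ :* d :+ δ :* (:1 :- δ)) :=
                     s :* s :+ δ :* (d :+ (s :+ s) :+ :1)) refl s δ d ⟩
              s * s + δ * m        ≈⟨ +-congˡ δm≈d ⟩
              s * s + (a - s * s)  ≈⟨ solve 2 (λ x a → x :+ (a :- x) := a) refl (s * s) a ⟩
              a ∎)

      -- For δ (2s + 1) = s² - a one has (s - δ)² = a + δ + δ², so s - δ, which is nonnegative,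
      -- would be a smaller upper bound of `S`.
      not-above : ¬ (a < s * s)
      not-above a<ss = go (fraction (<⇒≤ 0<d) 0<m)
        where
        d = s * s - a
        m = (s + s) + 1#
        0<d = x<y⇒0<y-x a<ss
        0<m : 0# < m
        0<m = <-respʳ-≈ (+-comm _ _) (+-pos 0<1 (+-nonneg √-nonneg √-nonneg))
        go : ¬ (∃[ δ ] 0# ≤ δ × δ * m ≈ d)
        go (δ , 0≤δ , δm≈d) = <⇒≱ 0<δ (≤-by (s - δ - s) (x≤y⇒0≤y-x s≤s-δ)
            (solve 2 (λ s δ → δ :+ (s :- δ :- s) := :0) refl s δ))
          where
          0<δ = pos-factor 0≤δ (<-respʳ-≈ (sym δm≈d) 0<d)
          δ≤s : δ ≤ s
          δ≤s = *-cancelʳ-≤ 0<m (begin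
            δ * m      ≈⟨ δm≈d ⟩
            s * s - a  ≤⟨ ≤-by (a + (s * s + s))
                           (+-nonneg 0≤a (+-nonneg (square-nonneg s) √-nonneg))
                           (solve 2 (λ s a → s :* s :- a :+ (a :+ (s :* s :+ s)) :=
                             s :* (s :+ s :+ :1)) refl s a) ⟩
            s * m      ∎)
          a≤ : a ≤ (s - δ) * (s - δ)
          a≤ = ≤-by (δ + δ * δ) (+-nonneg 0≤δ (*-nonneg 0≤δ 0≤δ)) (begin-equality
            a + (δ + δ * δ)
              ≈⟨ solve 3 (λ a s δ → a :+ (δ :+ δ :* δ) :=
                   (s :- δ) :* (s :- δ) :+ (δ :* (s :+ s :+ :1) :- (s :* s :- a))) refl a s δ ⟩
            (s - δ) * (s - δ) + (δ * m - d)
              ≈⟨ +-congˡ (trans (+-congʳ δm≈d) (-‿inverseʳ d)) ⟩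
            (s - δ) * (s - δ) + 0#  ≈⟨ +-identityʳ _ ⟩
            (s - δ) * (s - δ)       ∎)
          s≤s-δ : s ≤ s - δ
          s≤s-δ = sup-least (0# , S-0) λ tt≤a →
            square-cancel-≤ (x≤y⇒0≤y-x δ≤s) (≤-trans tt≤a a≤)

    √-square : √ a * √ a ≈ a
    √-square = ≤-antisym (≮⇒≥ not-above) (≮⇒≥ not-below)

  √-cong : 0# ≤ x → x ≈ y → √ x ≈ √ y
  √-cong {x} {y} 0≤x x≈y = square-cancel (√-nonneg 0≤x) (√-nonneg 0≤y)
    (trans (√-square 0≤x) (trans x≈y (sym (√-square 0≤y))))
    where
    0≤y = ≤-respʳ-≈ x≈y 0≤x

  √-unique : 0# ≤ y → y * y ≈ x → √ x ≈ y
  √-unique {y} {x} 0≤y yy≈x = square-cancel (√-nonneg 0≤x) 0≤y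
    (trans (√-square 0≤x) (sym yy≈x))
    where
    0≤x = ≤-respʳ-≈ yy≈x (square-nonneg y)

  √-pos : 0# < x → 0# < √ x
  √-pos {x} 0<x = √-nonneg (<⇒≤ 0<x) , λ 0≈√x → >⇒≉0 0<x
    (trans (sym (√-square (<⇒≤ 0<x))) (trans (*-congʳ (sym 0≈√x)) (zeroˡ _)))

  -- The element `t` itself makes the set of negatives nonempty and `b` bounds it, so the `sup`
  -- inside `inf` is specified.
  inf-lower : ∀ {S : Pred Carrier 0ℓ} b → (∀ {t} → S t → b ≤ t) → ∀ {t} → S t → inf S ≤ t
  inf-lower {S} b lower {t} St = ≤-respʳ-≈ (-‿involutive t) (-‿mono-≤
    (sup-upper (- t , t , St , refl)
      (- b , λ (s , Ss , x≈-s) → ≤-respˡ-≈ (sym x≈-s) (-‿mono-≤ (lower Ss)))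
      (t , St , refl)))

  common-positive-bound : 0# < x → 0# < y → ∃[ δ ] 0# < δ × δ ≤ x × δ ≤ y
  common-positive-bound {x} {y} 0<x 0<y with total x y
  ... | inj₁ x≤y = x , 0<x , ≤-refl , x≤y
  ... | inj₂ y≤x = y , 0<y , y≤x , ≤-refl

  common-positive-bound₃ : 0# < x → 0# < y → 0# < z → ∃[ δ ] 0# < δ × (δ ≤ x × δ ≤ y) × δ ≤ z
  common-positive-bound₃ 0<x 0<y 0<z with common-positive-bound 0<x 0<y
  ... | η , 0<η , η≤x , η≤y with common-positive-bound 0<η 0<z
  ...   | δ , 0<δ , δ≤η , δ≤z = δ , 0<δ , (≤-trans δ≤η η≤x , ≤-trans δ≤η η≤y) , δ≤z

  -- Take δ = d / (L + 1): the added 1 covers L = 0 and leaves the gap d - L δ = δ. This converts a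
  -- Lipschitz constant into a safe step length.
  positive-below : ∀ {d L} → 0# < d → 0# ≤ L → ∃[ δ ] 0# < δ × L * δ < d
  positive-below {d} {L} 0<d 0≤L = δ , 0<δ , 0<y-x⇒x<y (<-respʳ-≈ eq 0<δ)
    where
    0<L+1 : 0# < L + 1#
    0<L+1 = <-respʳ-≈ (+-comm _ _) (+-pos 0<1 0≤L)
    δ = d * (L + 1#) ⁻¹
    0<δ : 0# < δ
    0<δ = *-pos 0<d (⁻¹-pos 0<L+1)
    eq : δ ≈ d - L * δ
    eq = begin-equality
      δ                        ≈⟨ solve 2 (λ δ L → δ := δ :* (L :+ :1) :- L :* δ) refl δ L ⟩
      δ * (L + 1#) - L * δ     ≈⟨ +-congʳ (trans (*-assoc _ _ _) (*-congˡ (⁻¹-inverseˡ (>⇒≉0 0<L+1)))) ⟩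
      d * 1# - L * δ           ≈⟨ +-congʳ (*-identityʳ d) ⟩
      d - L * δ                ∎

  *-monoʳ-< : 0# < z → x < y → x * z < y * z
  *-monoʳ-< {z} {x} {y} 0<z x<y = 0<y-x⇒x<y (<-respʳ-≈
    (solve 3 (λ x y z → (y :- x) :* z := y :* z :- x :* z) refl x y z)
    (*-pos (x<y⇒0<y-x x<y) 0<z))

  ⁻¹-antitone : 0# < x → x ≤ y → y ⁻¹ ≤ x ⁻¹
  ⁻¹-antitone {x} {y} 0<x x≤y = *-cancelʳ-≤ 0<x (begin
    y ⁻¹ * x  ≤⟨ *-monoˡ-≤ (<⇒≤ (⁻¹-pos 0<y)) x≤y ⟩
    y ⁻¹ * y  ≈⟨ ⁻¹-inverseˡ (>⇒≉0 0<y) ⟩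
    1#        ≈⟨ ⁻¹-inverseˡ (>⇒≉0 0<x) ⟨
    x ⁻¹ * x  ∎)
    where
    0<y = <-≤-trans 0<x x≤y

-- The complex numbers and their modulus.

module ComplexField (em : ExcludedMiddle 0ℓ) (𝓡 : CompleteOrderedField) where
  open import Data.Fin.Base using (Fin) renaming (zero to fzero; suc to fsuc)
  open import Data.Nat.Base using (zero; suc)
  open import Relation.Nullary using (¬_; yes; no)

  open CompleteOrderedField 𝓡
  open CommutativeRingSolver commutativeRing
  open RealField em 𝓡
  open Complex 𝓡
  open import Relation.Binary.Reasoning.PartialOrder poset
  open import Algebra.Properties.Semiring.Exp semiring
  open import Algebra.Properties.Semiring.Sum semiring using (sum)

  private module C = RawRing ℂ-rawRing

  ℂ-commutativeRing : CommutativeRing 0ℓ 0ℓ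
  ℂ-commutativeRing = record
    { Carrier = ℂ
    ; _≈_ = C._≈_ ; _+_ = C._+_ ; _*_ = C._*_ ; -_ = C.-_ ; 0# = C.0# ; 1# = C.1#
    ; isCommutativeRing = record
      { isRing = record
        { +-isAbelianGroup = record
          { isGroup = record
            { isMonoid = record
              { isSemigroup = record
                { isMagma = record
                  { isEquivalence = record
                    { refl = refl , refl
                    ; sym = λ (p , q) → sym p , sym q
                    ; trans = λ (p , q) (r , s) → trans p r , trans q s
                    }
                  ; ∙-cong = λ (p , q) (r , s) → +-cong p r , +-cong q s
                  }
                ; assoc = λ _ _ _ → +-assoc _ _ _ , +-assoc _ _ _
                }
              ; identity =
                  (λ _ → +-identityˡ _ , +-identityˡ _) , (λ _ → +-identityʳ _ , +-identityʳ _)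
              }
            ; inverse =
                (λ _ → -‿inverseˡ _ , -‿inverseˡ _) , (λ _ → -‿inverseʳ _ , -‿inverseʳ _)
            ; ⁻¹-cong = λ (p , q) → -‿cong p , -‿cong q
            }
          ; comm = λ _ _ → +-comm _ _ , +-comm _ _
          }
        ; *-cong = λ (p , q) (r , s) →
            +-cong (*-cong p r) (-‿cong (*-cong q s)) , +-cong (*-cong p s) (*-cong q r)
        ; *-assoc = λ (a , b) (c , d) (e , f) →
            solve 6 (λ a b c d e f → (a :* c :- b :* d) :* e :- (a :* d :+ b :* c) :* f :=
              a :* (c :* e :- d :* f) :- b :* (c :* f :+ d :* e)) refl a b c d e f ,
            solve 6 (λ a b c d e f → (a :* c :- b :* d) :* f :+ (a :* d :+ b :* c) :* e :=
              a :* (c :* f :+ d :* e) :+ b :* (c :* e :- d :* f)) refl a b c d e f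
        ; *-identity =
            (λ (a , b) → solve 2 (λ a b → :1 :* a :- :0 :* b := a) refl a b ,
                         solve 2 (λ a b → :1 :* b :+ :0 :* a := b) refl a b) ,
            (λ (a , b) → solve 2 (λ a b → a :* :1 :- b :* :0 := a) refl a b ,
                         solve 2 (λ a b → a :* :0 :+ b :* :1 := b) refl a b)
        ; distrib =
            (λ (a , b) (c , d) (e , f) →
              solve 6 (λ a b c d e f → a :* (c :+ e) :- b :* (d :+ f) :=
                a :* c :- b :* d :+ (a :* e :- b :* f)) refl a b c d e f ,
              solve 6 (λ a b c d e f → a :* (d :+ f) :+ b :* (c :+ e) :=
                a :* d :+ b :* c :+ (a :* f :+ b :* e)) refl a b c d e f) ,
            (λ (a , b) (c , d) (e , f) →
              solve 6 (λ a b c d e f → (c :+ e) :* a :- (d :+ f) :* b :=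
                c :* a :- d :* b :+ (e :* a :- f :* b)) refl a b c d e f ,
              solve 6 (λ a b c d e f → (c :+ e) :* b :+ (d :+ f) :* a :=
                c :* b :+ d :* a :+ (e :* b :+ f :* a)) refl a b c d e f)
        }
      ; *-comm = λ (a , b) (c , d) →
          solve 4 (λ a b c d → a :* c :- b :* d := c :* a :- d :* b) refl a b c d ,
          solve 4 (λ a b c d → a :* d :+ b :* c := c :* b :+ d :* a) refl a b c d
      }
    }

  module ℂ = CommutativeRing ℂ-commutativeRing
  open import Algebra.Definitions.RawSemiring (RawRing.rawSemiring ℂ-rawRing)
    using () renaming (_^_ to _^ᶜ_; sum to sumᶜ; product to productᶜ)

  private
    variable z w : ℂ
    N : ℂ → Carrier
    N (a , b) = a * a + b * b

    N-nonneg : ∀ z → 0# ≤ N z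
    N-nonneg (a , b) = +-nonneg (square-nonneg a) (square-nonneg b)

    ∣∣-square : ∀ z → ∣ z ∣ * ∣ z ∣ ≈ N z
    ∣∣-square z = √-square (N-nonneg z)

  ∣∣-nonneg : ∀ z → 0# ≤ ∣ z ∣
  ∣∣-nonneg z = √-nonneg (N-nonneg z)

  ∣∣-cong : z ℂ.≈ w → ∣ z ∣ ≈ ∣ w ∣
  ∣∣-cong {z} (p , q) = √-cong (N-nonneg z) (+-cong (*-cong p p) (*-cong q q))

  ∣∣-* : ∀ z w → ∣ z ℂ.* w ∣ ≈ ∣ z ∣ * ∣ w ∣
  ∣∣-* z@(a , b) w@(c , d) = √-unique (*-nonneg (∣∣-nonneg z) (∣∣-nonneg w)) (begin-equality
    ∣ z ∣ * ∣ w ∣ * (∣ z ∣ * ∣ w ∣)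
      ≈⟨ solve 2 (λ x y → x :* y :* (x :* y) := x :* x :* (y :* y)) refl ∣ z ∣ ∣ w ∣ ⟩
    ∣ z ∣ * ∣ z ∣ * (∣ w ∣ * ∣ w ∣)
      ≈⟨ *-cong (∣∣-square z) (∣∣-square w) ⟩
    N z * N w
      ≈⟨ solve 4 (λ a b c d → (a :* a :+ b :* b) :* (c :* c :+ d :* d) :=
           (a :* c :- b :* d) :* (a :* c :- b :* d) :+ (a :* d :+ b :* c) :* (a :* d :+ b :* c))
           refl a b c d ⟩
    N (z ℂ.* w) ∎)

  ∣∣-+ : ∀ z w → ∣ z ℂ.+ w ∣ ≤ ∣ z ∣ + ∣ w ∣
  ∣∣-+ z@(a , b) w@(c , d) =
    square-cancel-≤ (+-nonneg (∣∣-nonneg z) (∣∣-nonneg w)) (begin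
      ∣ z ℂ.+ w ∣ * ∣ z ℂ.+ w ∣
        ≈⟨ ∣∣-square (z ℂ.+ w) ⟩
      N (z ℂ.+ w)
        ≈⟨ solve 4 (λ a b c d → (a :+ c) :* (a :+ c) :+ (b :+ d) :* (b :+ d) :=
             a :* a :+ b :* b :+ (c :* c :+ d :* d) :+ (a :* c :+ b :* d :+ (a :* c :+ b :* d)))
             refl a b c d ⟩
      N z + N w + (a * c + b * d + (a * c + b * d))
        ≤⟨ +-mono-≤ (≤-reflexive (+-cong (sym (∣∣-square z)) (sym (∣∣-square w))))
             (+-mono-≤ cauchy-schwarz cauchy-schwarz) ⟩
      ∣ z ∣ * ∣ z ∣ + ∣ w ∣ * ∣ w ∣ + (∣ z ∣ * ∣ w ∣ + ∣ z ∣ * ∣ w ∣)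
        ≈⟨ solve 2 (λ x y → x :* x :+ y :* y :+ (x :* y :+ x :* y) := (x :+ y) :* (x :+ y))
             refl ∣ z ∣ ∣ w ∣ ⟩
      (∣ z ∣ + ∣ w ∣) * (∣ z ∣ + ∣ w ∣) ∎)
    where
    -- Lagrange's identity: the squares of the two sides differ by (ad - bc)².
    cauchy-schwarz : a * c + b * d ≤ ∣ z ∣ * ∣ w ∣
    cauchy-schwarz = square-cancel-≤ (*-nonneg (∣∣-nonneg z) (∣∣-nonneg w))
      (≤-by ((a * d - b * c) * (a * d - b * c)) (square-nonneg _) (begin-equality
        (a * c + b * d) * (a * c + b * d) + (a * d - b * c) * (a * d - b * c)
          ≈⟨ solve 4 (λ a b c d →
               (a :* c :+ b :* d) :* (a :* c :+ b :* d) :+ (a :* d :- b :* c) :* (a :* d :- b :* c) :=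
               (a :* a :+ b :* b) :* (c :* c :+ d :* d)) refl a b c d ⟩
        N z * N w
          ≈⟨ *-cong (∣∣-square z) (∣∣-square w) ⟨
        ∣ z ∣ * ∣ z ∣ * (∣ w ∣ * ∣ w ∣)
          ≈⟨ solve 2 (λ x y → x :* x :* (y :* y) := x :* y :* (x :* y)) refl ∣ z ∣ ∣ w ∣ ⟩
        ∣ z ∣ * ∣ w ∣ * (∣ z ∣ * ∣ w ∣) ∎))

  ∣∣-neg : ∀ z → ∣ ℂ.- z ∣ ≈ ∣ z ∣
  ∣∣-neg z@(a , b) = √-cong (N-nonneg (ℂ.- z))
    (solve 2 (λ a b → :- a :* :- a :+ :- b :* :- b := a :* a :+ b :* b) refl a b)

  ∣∣-minus : ∀ z w → ∣ z ℂ.- w ∣ ≤ ∣ z ∣ + ∣ w ∣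
  ∣∣-minus z w = ≤-respʳ-≈ (+-congˡ (∣∣-neg w)) (∣∣-+ z (ℂ.- w))

  ∣∣-minus-lower : ∀ z w → ∣ z ∣ ≤ ∣ z ℂ.- w ∣ + ∣ w ∣
  ∣∣-minus-lower z@(a , b) w@(c , d) = ≤-respˡ-≈ (∣∣-cong {z ℂ.- w ℂ.+ w} {z}
    (solve 2 (λ a c → a :- c :+ c := a) refl a c , solve 2 (λ a c → a :- c :+ c := a) refl b d))
    (∣∣-+ (z ℂ.- w) w)

  re≤∣∣ : ∀ z → proj₁ z ≤ ∣ z ∣
  re≤∣∣ z@(a , b) = square-cancel-≤ (∣∣-nonneg z)
    (≤-respʳ-≈ (sym (∣∣-square z)) (≤-by (b * b) (square-nonneg b) refl))

  ∣ι∣ : ∀ {a} → 0# ≤ a → ∣ ι a ∣ ≈ a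
  ∣ι∣ {a} 0≤a = √-unique 0≤a (solve 1 (λ a → a :* a := a :* a :+ :0 :* :0) refl a)

  ∣∣-zero : z ℂ.≈ ℂ.0# → ∣ z ∣ ≈ 0#
  ∣∣-zero z≈0 = trans (∣∣-cong z≈0) (∣ι∣ ≤-refl)

  ∣∣-pos : ¬ (z ℂ.≈ ℂ.0#) → 0# < ∣ z ∣
  ∣∣-pos {z@(a , b)} z≉0 = ∣∣-nonneg z , λ 0≈∣z∣ →
    let N≤0 = ≤-reflexive (trans (sym (∣∣-square z)) (trans (*-congʳ (sym 0≈∣z∣)) (zeroˡ _))) in
    z≉0 ( square≤0 (≤-trans (≤-by (b * b) (square-nonneg b) refl) N≤0)
        , square≤0 (≤-trans (≤-by (a * a) (square-nonneg a) (+-comm _ _)) N≤0))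
    where
    square≤0 : ∀ {x} → x * x ≤ 0# → x ≈ 0#
    square≤0 {x} xx≤0 with em {x ≈ 0#}
    ... | yes x≈0 = x≈0
    ... | no x≉0 = *-zero-cancelˡ x≉0 (≤-antisym xx≤0 (square-nonneg x))

  ⁻¹ᶜ-inverse : ¬ (z ℂ.≈ ℂ.0#) → z ℂ.* z ⁻¹ᶜ ℂ.≈ ℂ.1#
  ⁻¹ᶜ-inverse {z@(a , b)} z≉0 =
    trans (solve 3 (λ a b n → a :* (a :* n) :- b :* (:- b :* n) := (a :* a :+ b :* b) :* n) refl a b _)
      (⁻¹-inverseʳ N≉0) ,
    solve 3 (λ a b n → a :* (:- b :* n) :+ b :* (a :* n) := :0) refl a b _
    where
    N≉0 : ¬ (N z ≈ 0#)
    N≉0 N≈0 = >⇒≉0 (*-pos (∣∣-pos z≉0) (∣∣-pos z≉0)) (trans (∣∣-square z) N≈0)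

  ∣⁻¹ᶜ∣ : ¬ (z ℂ.≈ ℂ.0#) → ∣ z ⁻¹ᶜ ∣ * ∣ z ∣ ≈ 1#
  ∣⁻¹ᶜ∣ {z} z≉0 = begin-equality
    ∣ z ⁻¹ᶜ ∣ * ∣ z ∣    ≈⟨ *-comm _ _ ⟩
    ∣ z ∣ * ∣ z ⁻¹ᶜ ∣    ≈⟨ ∣∣-* z (z ⁻¹ᶜ) ⟨
    ∣ z ℂ.* z ⁻¹ᶜ ∣      ≈⟨ ∣∣-cong {z ℂ.* z ⁻¹ᶜ} {ℂ.1#} (⁻¹ᶜ-inverse z≉0) ⟩
    ∣ ι 1# ∣             ≈⟨ ∣ι∣ (<⇒≤ 0<1) ⟩
    1#                   ∎

  ∣∣-^ : ∀ z n → ∣ z ^ᶜ n ∣ ≈ ∣ z ∣ ^ n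
  ∣∣-^ z zero = ∣ι∣ (<⇒≤ 0<1)
  ∣∣-^ z (suc n) = trans (∣∣-* z (z ^ᶜ n)) (*-congˡ (∣∣-^ z n))

  ∣∣-sum : ∀ {n} (f : Fin n → ℂ) → ∣ sumᶜ f ∣ ≤ sum (λ i → ∣ f i ∣)
  ∣∣-sum {zero} f = ≤-reflexive (∣ι∣ ≤-refl)
  ∣∣-sum {suc n} f = ≤-trans (∣∣-+ (f fzero) (sumᶜ λ i → f (fsuc i)))
    (+-mono-≤ ≤-refl (∣∣-sum λ i → f (fsuc i)))

  ∣∣-product : ∀ {n} (f : Fin n → ℂ) {M} → (∀ i → ∣ f i ∣ ≤ M) → ∣ productᶜ f ∣ ≤ M ^ n
  ∣∣-product {zero} f f≤M = ≤-reflexive (∣ι∣ (<⇒≤ 0<1))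
  ∣∣-product {suc n} f {M} f≤M = begin
    ∣ productᶜ f ∣
      ≈⟨ ∣∣-* (f fzero) (productᶜ λ i → f (fsuc i)) ⟩
    ∣ f fzero ∣ * ∣ productᶜ (λ i → f (fsuc i)) ∣
      ≤⟨ *-mono-≤ (∣∣-nonneg (f fzero)) (∣∣-nonneg (productᶜ λ i → f (fsuc i)))
           (f≤M fzero) (∣∣-product (λ i → f (fsuc i)) λ i → f≤M (fsuc i)) ⟩
    M ^ suc n ∎

  ι-cong : ∀ {a b} → a ≈ b → ι a ℂ.≈ ι b
  ι-cong a≈b = a≈b , refl

  ι-* : ∀ a b → ι a ℂ.* ι b ℂ.≈ ι (a * b)
  ι-* a b = solve 2 (λ a b → a :* b :- :0 :* :0 := a :* b) refl a b ,
            solve 2 (λ a b → a :* :0 :+ :0 :* b := :0) refl a b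

  ι-minus : ∀ a b → ι a ℂ.- ι b ℂ.≈ ι (a - b)
  ι-minus a b = refl , -‿inverseʳ 0#

  ι-^ : ∀ a n → ι a ^ᶜ n ℂ.≈ ι (a ^ n)
  ι-^ a zero = refl , refl
  ι-^ a (suc n) = ℂ.trans (ℂ.*-congˡ {ι a} (ι-^ a n)) (ι-* a (a ^ n))

  ι-sum : ∀ {n} (f : Fin n → Carrier) → sumᶜ (λ i → ι (f i)) ℂ.≈ ι (sum f)
  ι-sum {zero} f = refl , refl
  ι-sum {suc n} f = ℂ.trans (ℂ.+-congˡ {ι (f fzero)} (ι-sum λ i → f (fsuc i)))
    (refl , +-identityˡ 0#)

-- Zeros of continuants and the spectral radius.

module Spectrum (em : ExcludedMiddle 0ℓ) (𝓡 : CompleteOrderedField) where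
  open import Data.Bool.Base using (Bool; true; false; if_then_else_)
  open import Data.Empty using (⊥-elim)
  open import Data.Fin.Base using (Fin; toℕ) renaming (zero to fzero; suc to fsuc)
  import Data.Fin.Properties as Fin
  open import Data.Nat.Base using (zero; suc; _≡ᵇ_; z≤n; s≤s)
  import Data.Nat.Properties as ℕ
  open import Data.Sum.Base using (inj₁; inj₂)
  open import Relation.Nullary using (¬_; yes; no)
  open import Relation.Binary.PropositionalEquality as ≡ using (_≡_)

  open CompleteOrderedField 𝓡
  open CommutativeRingSolver commutativeRing
  open RealField em 𝓡
  open ComplexField em 𝓡
  open Continuants commutativeRing
  open Analysis 𝓡 using (∣_∣; ι; ℂ; Matrix; IsEigenvalue; spectralRadius; A; Λ; sumᶜ; _*ᶜ_)
  open import Relation.Binary.Reasoning.PartialOrder poset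
  open import Algebra.Properties.Semiring.Exp semiring
  open import Algebra.Properties.Ring ring using (-0#≈0#)
  open import Algebra.Properties.Semiring.Sum semiring
    using (sum; sum-cong-≋; ∑-distrib-+; *-distribˡ-sum; *-distribʳ-sum)
  open import Algebra.Properties.Semiring.Sum ℂ.semiring
    using () renaming (sum-cong-≋ to sumᶜ-cong-≋)

  sum-mono-≤ : ∀ {n} {f g : Fin n → Carrier} → (∀ i → f i ≤ g i) → sum f ≤ sum g
  sum-mono-≤ {zero} f≤g = ≤-refl
  sum-mono-≤ {suc n} f≤g = +-mono-≤ (f≤g fzero) (sum-mono-≤ λ i → f≤g (fsuc i))

  sum-nonneg : ∀ {n} (f : Fin n → Carrier) → (∀ i → 0# ≤ f i) → 0# ≤ sum f
  sum-nonneg {zero} f 0≤f = ≤-refl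
  sum-nonneg {suc n} f 0≤f = +-nonneg (0≤f fzero) (sum-nonneg (λ i → f (fsuc i)) λ i → 0≤f (fsuc i))

  ≤sum : ∀ {n} (f : Fin n → Carrier) → (∀ i → 0# ≤ f i) → ∀ i → f i ≤ sum f
  ≤sum f 0≤f fzero = ≤-by _ (sum-nonneg (λ i → f (fsuc i)) λ i → 0≤f (fsuc i)) refl
  ≤sum f 0≤f (fsuc i) = ≤-trans (≤sum (λ i → f (fsuc i)) (λ i → 0≤f (fsuc i)) i)
    (≤-by (f fzero) (0≤f fzero) (+-comm _ _))

  -- Compare the ℓ¹ norms of v and M v. The bound is crude, but it makes the set of moduli of
  -- eigenvalues bounded, so that its supremum is specified.
  ∣eigenvalue∣≤sum : ∀ {n} (M : Matrix n) {μ} → IsEigenvalue M μ →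
    ∣ μ ∣ ≤ sum (λ i → sum λ j → ∣ ι (M i j) ∣)
  ∣eigenvalue∣≤sum M {μ} (v , (i₀ , vi₀≉0) , Mv≈μv) = *-cancelʳ-≤ 0<S (begin
    ∣ μ ∣ * S                       ≈⟨ *-distribˡ-sum ∣ μ ∣ (λ i → ∣ v i ∣) ⟩
    sum (λ i → ∣ μ ∣ * ∣ v i ∣)     ≤⟨ sum-mono-≤ row≤ ⟩
    sum (λ i → row i * S)           ≈⟨ *-distribʳ-sum S row ⟨
    sum row * S                     ∎)
    where
    S = sum λ i → ∣ v i ∣
    row : _ → Carrier
    row i = sum λ j → ∣ ι (M i j) ∣
    v≤S : ∀ j → ∣ v j ∣ ≤ S
    v≤S = ≤sum (λ i → ∣ v i ∣) (λ i → ∣∣-nonneg (v i))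
    0<S : 0# < S
    0<S = <-≤-trans (∣∣-pos vi₀≉0) (v≤S i₀)
    row≤ : ∀ i → ∣ μ ∣ * ∣ v i ∣ ≤ row i * S
    row≤ i = begin
      ∣ μ ∣ * ∣ v i ∣                          ≈⟨ ∣∣-* μ (v i) ⟨
      ∣ μ *ᶜ v i ∣                             ≈⟨ ∣∣-cong (Mv≈μv i) ⟨
      ∣ sumᶜ (λ j → ι (M i j) *ᶜ v j) ∣        ≤⟨ ∣∣-sum (λ j → ι (M i j) *ᶜ v j) ⟩
      sum (λ j → ∣ ι (M i j) *ᶜ v j ∣)         ≤⟨ sum-mono-≤ (λ j → ≤-trans
                                                    (≤-reflexive (∣∣-* (ι (M i j)) (v j)))
                                                    (*-monoˡ-≤ (∣∣-nonneg (ι (M i j))) (v≤S j))) ⟩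
      sum (λ j → ∣ ι (M i j) ∣ * S)            ≈⟨ *-distribʳ-sum S (λ j → ∣ ι (M i j) ∣) ⟨
      row i * S                                ∎

  eigenvalue≤spectralRadius : ∀ {n} (M : Matrix n) {μ} → IsEigenvalue M μ → ∣ μ ∣ ≤ spectralRadius M
  eigenvalue≤spectralRadius M {μ} eig = sup-upper (∣ μ ∣ , μ , eig , refl)
    (_ , λ (ν , eig′ , t≈∣ν∣) → ≤-respˡ-≈ (sym t≈∣ν∣) (∣eigenvalue∣≤sum M eig′))
    (μ , eig , refl)

  ≡ᵇ-comm : ∀ m n → (m ≡ᵇ n) ≡ (n ≡ᵇ m)
  ≡ᵇ-comm zero zero = ≡.refl
  ≡ᵇ-comm zero (suc n) = ≡.refl
  ≡ᵇ-comm (suc m) zero = ≡.refl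
  ≡ᵇ-comm (suc m) (suc n) = ≡ᵇ-comm m n

  Σ<-indicator : ∀ {n k} (f : ℕ → Carrier) → k ℕ.< n →
    Σ< n (λ j → if j ≡ᵇ k then f j else 0#) ≈ f k
  Σ<-indicator {suc n} {zero} f (s≤s z≤n) = trans (+-congˡ (Σ<-zero n λ _ → refl)) (+-identityʳ _)
  Σ<-indicator {suc n} {suc k} f (s≤s k<n) =
    trans (+-identityˡ _) (Σ<-indicator (λ j → f (suc j)) k<n)

  -- The case k = n is the last row of the matrix, whose right neighbour lies outside. The missing
  -- term is zero because the vector entry there is a multiple of the vanishing continuant.
  Σ<-indicator-≤ : ∀ {n k} (f : ℕ → Carrier) → k ℕ.≤ n → f n ≈ 0# →
    Σ< n (λ j → if j ≡ᵇ k then f j else 0#) ≈ f k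
  Σ<-indicator-≤ {n} {k} f k≤n fn≈0 with ℕ.m≤n⇒m<n∨m≡n k≤n
  ... | inj₁ k<n = Σ<-indicator f k<n
  ... | inj₂ ≡.refl = trans (zero-sum f n) (sym fn≈0)
    where
    zero-sum : ∀ (f : ℕ → Carrier) n → Σ< n (λ j → if j ≡ᵇ n then f j else 0#) ≈ 0#
    zero-sum f zero = refl
    zero-sum f (suc n) = trans (+-identityˡ _) (zero-sum (λ j → f (suc j)) n)

  E : Carrier → Carrier → ℕ → Carrier
  E r X = continuant λ j → r ^ j * X

  module Eigenvector {r X : Carrier} (0<r : 0# < r) (0<X : 0# < X) (m : ℕ)
    (e≈0 : E r X (suc m) ≈ 0#) where
    private
      e : ℕ → Carrier
      e = E r X

      s = √ X
      b : ℕ → Carrier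
      b i = √ (r ^ i)
      0<s : 0# < s
      0<s = √-pos 0<X
      sb≉0 : ∀ i → ¬ (s * b i ≈ 0#)
      sb≉0 i = >⇒≉0 (*-pos 0<s (√-pos (^-pos 0<r i)))

      -- The product of 1 / (√X b j) over j < i. This scaling symmetrises the recurrence: it turns
      -- the weight r^i X = (√X b i)² into one factor on each side of the diagonal.
      c : ℕ → Carrier
      c zero = 1#
      c (suc i) = c i * (s * b i) ⁻¹

      c-step : ∀ i → c i ≈ c (suc i) * (s * b i)
      c-step i = sym (trans (*-assoc _ _ _)
        (trans (*-congˡ (⁻¹-inverseˡ (sb≉0 i))) (*-identityʳ _)))

      v : ℕ → Carrier
      v i = e i * c i

      -- The two tests exclude each other, so a row of `A` is the sum of its superdiagonal and its
      -- subdiagonal part.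
      split : ∀ i j α β x →
        (if j ≡ᵇ suc i then α else if i ≡ᵇ suc j then β else 0#) * x ≈
        (if j ≡ᵇ suc i then α * x else 0#) + (if i ≡ᵇ suc j then β * x else 0#)
      split zero j α β x with j ≡ᵇ 1
      ... | true = sym (+-identityʳ _)
      ... | false = trans (zeroˡ _) (sym (+-identityʳ _))
      split (suc i) zero α β x with i ≡ᵇ 0
      ... | true = sym (+-identityˡ _)
      ... | false = trans (zeroˡ _) (sym (+-identityʳ _))
      split (suc i) (suc j) = split i j

      previous : ℕ → Carrier
      previous zero = 0#
      previous (suc i) = b i * v i

      lower : ∀ i → i ℕ.< suc m →
        Σ< (suc m) (λ j → if i ≡ᵇ suc j then b j * v j else 0#) ≈ previous i
      lower zero _ = Σ<-zero (suc m) λ _ → refl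
      lower (suc i) i<m = trans (Σ<-cong (suc m)
        λ j → reflexive (≡.cong (if_then b j * v j else 0#) (≡ᵇ-comm i j)))
        (Σ<-indicator (λ j → b j * v j) (ℕ.<-trans (ℕ.n<1+n i) i<m))

      eigen-equation : ∀ i → b i * v (suc i) + previous i ≈ s ⁻¹ * v i
      eigen-equation zero = begin-equality
        b 0 * (1# * u) + 0#
          ≈⟨ solve 2 (λ b u → b :* (:1 :* u) :+ :0 := b :* u) refl (b 0) u ⟩
        b 0 * u                      ≈⟨ *-identityˡ _ ⟨
        1# * (b 0 * u)               ≈⟨ *-congʳ (⁻¹-inverseˡ (>⇒≉0 0<s)) ⟨
        s ⁻¹ * s * (b 0 * u)
          ≈⟨ solve 4 (λ t s b u → t :* s :* (b :* u) := t :* (:1 :* (u :* (s :* b)))) refl (s ⁻¹) s (b 0) u ⟩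
        s ⁻¹ * (1# * (u * (s * b 0)))  ≈⟨ *-congˡ (*-congˡ (c-step 0)) ⟨
        s ⁻¹ * v 0                   ∎
        where u = c 1
      eigen-equation (suc i) = begin-equality
        b₁ * (e (2 ℕ.+ i) * u) + b₀ * (e₀ * c i)
          -- Expressing `c i` through `u` puts all terms on one scale; the terms in e₀ then cancel
          -- because b₀² s² = r^i X.
          ≈⟨ +-congˡ (*-congˡ (*-congˡ (trans (c-step i) (*-congʳ (c-step (suc i)))))) ⟩
        b₁ * (e (2 ℕ.+ i) * u) + b₀ * (e₀ * (u * (s * b₁) * (s * b₀)))
          ≈⟨ solve 8 (λ b₁ b₀ e₁ e₀ ρ X u s →
               b₁ :* ((e₁ :- ρ :* X :* e₀) :* u) :+ b₀ :* (e₀ :* (u :* (s :* b₁) :* (s :* b₀))) :=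
               b₁ :* u :* e₁ :+ b₁ :* u :* e₀ :* ((b₀ :* b₀) :* (s :* s) :- ρ :* X))
               refl b₁ b₀ e₁ e₀ (r ^ i) X u s ⟩
        b₁ * u * e₁ + b₁ * u * e₀ * ((b₀ * b₀) * (s * s) - r ^ i * X)
          ≈⟨ +-congˡ (*-congˡ (+-congʳ (*-cong (√-square (<⇒≤ (^-pos 0<r i))) (√-square (<⇒≤ 0<X))))) ⟩
        b₁ * u * e₁ + b₁ * u * e₀ * (r ^ i * X - r ^ i * X)
          ≈⟨ solve 5 (λ b u e₁ e₀ x → b :* u :* e₁ :+ b :* u :* e₀ :* (x :- x) := :1 :* (b :* u :* e₁))
               refl b₁ u e₁ e₀ (r ^ i * X) ⟩
        1# * (b₁ * u * e₁)           ≈⟨ *-congʳ (⁻¹-inverseˡ (>⇒≉0 0<s)) ⟨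
        s ⁻¹ * s * (b₁ * u * e₁)
          ≈⟨ solve 5 (λ t s b u e → t :* s :* (b :* u :* e) := t :* (e :* (u :* (s :* b)))) refl
               (s ⁻¹) s b₁ u e₁ ⟩
        s ⁻¹ * (e₁ * (u * (s * b₁)))  ≈⟨ *-congˡ (*-congˡ (c-step (suc i))) ⟨
        s ⁻¹ * v (suc i)             ∎
        where
        b₁ = b (suc i)
        b₀ = b i
        e₁ = e (suc i)
        e₀ = e i
        u = c (2 ℕ.+ i)

    isEigenvalue : IsEigenvalue (A (suc m) r) (ι (s ⁻¹))
    isEigenvalue = (λ i → ι (v (toℕ i))) , (fzero , λ (v≈0 , _) →
        0≉1 (sym (trans (sym (*-identityʳ 1#)) v≈0))) , λ i →
      ℂ.trans (sumᶜ-cong-≋ {suc m} λ j → ι-* (A (suc m) r i j) (v (toℕ j)))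
        (ℂ.trans (ι-sum {suc m} λ j → A (suc m) r i j * v (toℕ j))
        (ℂ.trans (ι-cong (row (toℕ i) (Fin.toℕ<n i))) (ℂ.sym (ι-* (s ⁻¹) (v (toℕ i))))))
      where
      row : ∀ i → i ℕ.< suc m → Σ< (suc m) (λ j →
        (if j ≡ᵇ suc i then b i else if i ≡ᵇ suc j then b j else 0#) * v j) ≈ s ⁻¹ * v i
      row i i<n = begin-equality
        Σ< (suc m) (λ j → (if j ≡ᵇ suc i then b i else if i ≡ᵇ suc j then b j else 0#) * v j)
          ≈⟨ Σ<-cong (suc m) (λ j → split i j (b i) (b j) (v j)) ⟩
        Σ< (suc m) (λ j → (if j ≡ᵇ suc i then b i * v j else 0#) +
          (if i ≡ᵇ suc j then b j * v j else 0#))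
          ≈⟨ ∑-distrib-+ {suc m} (λ j → if toℕ j ≡ᵇ suc i then b i * v (toℕ j) else 0#)
               (λ j → if i ≡ᵇ suc (toℕ j) then b (toℕ j) * v (toℕ j) else 0#) ⟩
        Σ< (suc m) (λ j → if j ≡ᵇ suc i then b i * v j else 0#) +
          Σ< (suc m) (λ j → if i ≡ᵇ suc j then b j * v j else 0#)
          ≈⟨ +-cong (Σ<-indicator-≤ (λ j → b i * v j) i<n
               (trans (*-congˡ (trans (*-congʳ e≈0) (zeroˡ _))) (zeroʳ _))) (lower i i<n) ⟩
        b i * v (suc i) + previous i  ≈⟨ eigen-equation i ⟩
        s ⁻¹ * v i ∎

    -- The eigenvalue 1/√X is at most the spectral radius; square this and multiply by X.
    Λ-lower : 1# ≤ X * Λ (suc m) r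
    Λ-lower = begin
      1#                             ≈⟨ *-identityʳ 1# ⟨
      1# * 1#                        ≈⟨ *-cong (⁻¹-inverseʳ (>⇒≉0 0<s)) (⁻¹-inverseʳ (>⇒≉0 0<s)) ⟨
      s * s ⁻¹ * (s * s ⁻¹)          ≈⟨ solve 2 (λ s t → s :* t :* (s :* t) := (s :* s) :* (t :^ 2)) refl s (s ⁻¹) ⟩
      s * s * (s ⁻¹) ^ 2             ≈⟨ *-congʳ (√-square (<⇒≤ 0<X)) ⟩
      X * (s ⁻¹) ^ 2                 ≤⟨ *-monoˡ-≤ (<⇒≤ 0<X) (^-monoˡ-≤ (<⇒≤ (⁻¹-pos 0<s)) s⁻¹≤ρ 2) ⟩
      X * Λ (suc m) r                ∎
      where
      s⁻¹≤ρ : s ⁻¹ ≤ spectralRadius (A (suc m) r)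
      s⁻¹≤ρ = ≤-respˡ-≈ (∣ι∣ (<⇒≤ (⁻¹-pos 0<s))) (eigenvalue≤spectralRadius (A (suc m) r) isEigenvalue)

  -- Positivity of the continuants below the first zero.

  module ContinuantSign {r : Carrier} (0<r : 0# < r) where
    private
      e : Carrier → ℕ → Carrier
      e = E r

    module _ {B : Carrier} (0≤B : 0# ≤ B) where
      private
        -- The absolute value on the real line, taken as the modulus on the real axis so that the
        -- modulus lemmas carry over.
        ‖_‖ : Carrier → Carrier
        ‖ x ‖ = ∣ ι x ∣

        ‖‖-* : ∀ x y → ‖ x * y ‖ ≈ ‖ x ‖ * ‖ y ‖
        ‖‖-* x y = trans (∣∣-cong (ℂ.sym (ι-* x y))) (∣∣-* (ι x) (ι y))

        ‖‖-minus : ∀ x y → ‖ x - y ‖ ≤ ‖ x ‖ + ‖ y ‖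
        ‖‖-minus x y = ≤-trans (≤-reflexive (∣∣-cong (ℂ.sym (ι-minus x y)))) (∣∣-minus (ι x) (ι y))

        ‖‖-cong : ∀ {x y} → x ≈ y → ‖ x ‖ ≈ ‖ y ‖
        ‖‖-cong x≈y = ∣∣-cong (ι-cong x≈y)

        ‖‖-swap : ∀ x y → ‖ x - y ‖ ≈ ‖ y - x ‖
        ‖‖-swap x y = begin-equality
          ‖ x - y ‖         ≈⟨ ∣∣-neg (ι (x - y)) ⟨
          ∣ ℂ.- ι (x - y) ∣  ≈⟨ ∣∣-cong { ℂ.- ι (x - y)} {ι (y - x)}
                                (solve 2 (λ x y → :- (x :- y) := y :- x) refl x y , -0#≈0#) ⟩
          ‖ y - x ‖         ∎

      -- Quantitative continuity on [0 , B]. The size bound `M` travels with the Lipschitz constant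
      -- because the recurrence contains the product of X and a continuant, whose Lipschitz constant
      -- depends on both.
      record Bounds (f : Carrier → Carrier) : Set where
        field
          M L : Carrier
          0≤M : 0# ≤ M
          0≤L : 0# ≤ L
          bound : ∀ x → 0# ≤ x → x ≤ B → ∣ ι (f x) ∣ ≤ M
          lipschitz : ∀ x y → 0# ≤ x → x ≤ B → 0# ≤ y → y ≤ B →
            ∣ ι (f x - f y) ∣ ≤ L * ∣ ι (x - y) ∣

      bounds-1 : Bounds λ _ → 1#
      bounds-1 = record
        { M = 1# ; L = 0# ; 0≤M = <⇒≤ 0<1 ; 0≤L = ≤-refl
        ; bound = λ _ _ _ → ≤-reflexive (∣ι∣ (<⇒≤ 0<1))
        ; lipschitz = λ x y _ _ _ _ → ≤-reflexive (trans (‖‖-cong (-‿inverseʳ 1#))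
            (trans (∣ι∣ ≤-refl) (sym (zeroˡ _))))
        }
      bounds-step : ∀ i → Bounds (λ X → e X i) → Bounds (λ X → e X (suc i)) →
        Bounds (λ X → e X (2 ℕ.+ i))
      bounds-step i bounds₀ bounds₁ = record
        { M = F₁.M + ρ * B * F₀.M
        ; L = F₁.L + ρ * (B * F₀.L + F₀.M)
        ; 0≤M = +-nonneg F₁.0≤M (*-nonneg (*-nonneg 0≤ρ 0≤B) F₀.0≤M)
        ; 0≤L = +-nonneg F₁.0≤L (*-nonneg 0≤ρ (+-nonneg (*-nonneg 0≤B F₀.0≤L) F₀.0≤M))
        ; bound = λ x 0≤x x≤B → ≤-trans (‖‖-minus (e x (suc i)) (ρ * x * e x i))
            (+-mono-≤ (F₁.bound x 0≤x x≤B) (begin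
              ‖ ρ * x * e x i ‖
                ≈⟨ ‖‖-* (ρ * x) (e x i) ⟩
              ‖ ρ * x ‖ * ‖ e x i ‖
                ≈⟨ *-congʳ (∣ι∣ (*-nonneg 0≤ρ 0≤x)) ⟩
              ρ * x * ‖ e x i ‖
                ≤⟨ *-mono-≤ (*-nonneg 0≤ρ 0≤x) (∣∣-nonneg (ι (e x i))) (*-monoˡ-≤ 0≤ρ x≤B)
                     (F₀.bound x 0≤x x≤B) ⟩
              ρ * B * F₀.M ∎))
        ; lipschitz = lip
        }
        where
        module F₀ = Bounds bounds₀
        module F₁ = Bounds bounds₁
        ρ = r ^ i
        0≤ρ = <⇒≤ (^-pos 0<r i)
        lip : ∀ x y → 0# ≤ x → x ≤ B → 0# ≤ y → y ≤ B →
          ‖ e x (2 ℕ.+ i) - e y (2 ℕ.+ i) ‖ ≤ (F₁.L + ρ * (B * F₀.L + F₀.M)) * ‖ x - y ‖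
        lip x y 0≤x x≤B 0≤y y≤B = begin
          ‖ (e x (suc i) - ρ * x * fx) - (e y (suc i) - ρ * y * fy) ‖
            ≈⟨ ‖‖-cong (solve 7 (λ x y ρ fx fy gx gy →
                 gx :- ρ :* x :* fx :- (gy :- ρ :* y :* fy) :=
                 gx :- gy :- ρ :* (x :* (fx :- fy) :- (y :- x) :* fy)) refl
                 x y ρ fx fy (e x (suc i)) (e y (suc i))) ⟩
          ‖ e x (suc i) - e y (suc i) - ρ * (x * (fx - fy) - (y - x) * fy) ‖
            ≤⟨ ‖‖-minus _ _ ⟩
          ‖ e x (suc i) - e y (suc i) ‖ + ‖ ρ * (x * (fx - fy) - (y - x) * fy) ‖
            ≤⟨ +-mono-≤ (F₁.lipschitz x y 0≤x x≤B 0≤y y≤B) (begin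
                 ‖ ρ * (x * (fx - fy) - (y - x) * fy) ‖
                   ≈⟨ trans (‖‖-* _ _) (*-congʳ (∣ι∣ 0≤ρ)) ⟩
                 ρ * ‖ x * (fx - fy) - (y - x) * fy ‖
                   ≤⟨ *-monoˡ-≤ 0≤ρ (≤-trans (‖‖-minus _ _) (+-mono-≤ first second)) ⟩
                 ρ * (B * (F₀.L * ‖ x - y ‖) + ‖ x - y ‖ * F₀.M) ∎) ⟩
          F₁.L * ‖ x - y ‖ + ρ * (B * (F₀.L * ‖ x - y ‖) + ‖ x - y ‖ * F₀.M)
            ≈⟨ solve 6 (λ L₁ L₀ M₀ B ρ d → L₁ :* d :+ ρ :* (B :* (L₀ :* d) :+ d :* M₀) :=
                 (L₁ :+ ρ :* (B :* L₀ :+ M₀)) :* d) refl F₁.L F₀.L F₀.M B ρ ‖ x - y ‖ ⟩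
          (F₁.L + ρ * (B * F₀.L + F₀.M)) * ‖ x - y ‖ ∎
          where
          fx = e x i
          fy = e y i
          first : ‖ x * (fx - fy) ‖ ≤ B * (F₀.L * ‖ x - y ‖)
          first = begin
            ‖ x * (fx - fy) ‖          ≈⟨ trans (‖‖-* _ _) (*-congʳ (∣ι∣ 0≤x)) ⟩
            x * ‖ fx - fy ‖            ≤⟨ *-mono-≤ 0≤x (∣∣-nonneg (ι (fx - fy))) x≤B
                                           (F₀.lipschitz x y 0≤x x≤B 0≤y y≤B) ⟩
            B * (F₀.L * ‖ x - y ‖)     ∎
          second : ‖ (y - x) * fy ‖ ≤ ‖ x - y ‖ * F₀.M
          second = begin
            ‖ (y - x) * fy ‖       ≈⟨ trans (‖‖-* _ _) (*-congʳ (‖‖-swap y x)) ⟩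
            ‖ x - y ‖ * ‖ fy ‖     ≤⟨ *-monoˡ-≤ (∣∣-nonneg (ι (x - y))) (F₀.bound y 0≤y y≤B) ⟩
            ‖ x - y ‖ * F₀.M       ∎

      bounds : ∀ i → Bounds λ X → e X i
      bounds zero = bounds-1
      bounds (suc zero) = bounds-1
      bounds (suc (suc i)) = bounds-step i (bounds i) (bounds (suc i))

      module _ (i : ℕ) where
        open Bounds (bounds i)

        decrease≤ : ∀ {x y} → 0# ≤ x → x ≤ y → y ≤ B → e x i - e y i ≤ L * (y - x)
        decrease≤ {x} {y} 0≤x x≤y y≤B = begin
          e x i - e y i        ≤⟨ re≤∣∣ (ι (e x i - e y i)) ⟩
          ‖ e x i - e y i ‖    ≤⟨ lipschitz x y 0≤x (≤-trans x≤y y≤B) (≤-trans 0≤x x≤y) y≤B ⟩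
          L * ‖ x - y ‖        ≈⟨ *-congˡ (trans (‖‖-swap x y) (∣ι∣ (x≤y⇒0≤y-x x≤y))) ⟩
          L * (y - x)          ∎

    module FirstZero (m : ℕ) {B : Carrier} (0≤B : 0# ≤ B) where
      Good : Pred Carrier 0ℓ
      Good X = ∀ i → i ℕ.≤ suc m → 0# < e X i

      module _ (¬good : ¬ Good B) where
        private
          S : Pred Carrier 0ℓ
          S X = (0# ≤ X × X ≤ B) × Good X

        e-at-0 : ∀ {X} → X ≈ 0# → ∀ i → e X i ≈ 1#
        e-at-0 X≈0 zero = refl
        e-at-0 X≈0 (suc zero) = refl
        e-at-0 {X} X≈0 (suc (suc i)) = begin-equality
          e X (suc i) - r ^ i * X * e X i
            ≈⟨ +-cong (e-at-0 X≈0 (suc i)) (-‿cong (*-congʳ (*-congˡ X≈0))) ⟩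
          1# - r ^ i * 0# * e X i
            ≈⟨ solve 2 (λ ρ e → :1 :- ρ :* :0 :* e := :1) refl (r ^ i) (e X i) ⟩
          1# ∎

        good-at-0 : ∀ {X} → X ≈ 0# → Good X
        good-at-0 X≈0 i _ = <-respʳ-≈ (sym (e-at-0 X≈0 i)) 0<1

        private
          S-0 : S 0#
          S-0 = (≤-refl , 0≤B) , good-at-0 refl

        -- The set `S` is not assumed to be an interval. What matters is that good points come
        -- arbitrarily close to X₀ from below and that no good point of [0 , B] lies above it.
        X₀ : Carrier
        X₀ = sup S

        private
          S≤X₀ : IsUpperBound S X₀
          S≤X₀ = sup-upper (0# , S-0) (B , λ ((_ , X≤B) , _) → X≤B)

          0≤X₀ : 0# ≤ X₀
          0≤X₀ = S≤X₀ S-0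

        X₀≤B : X₀ ≤ B
        X₀≤B = sup-least (0# , S-0) λ ((_ , X≤B) , _) → X≤B

        -- If the value were -d < 0, the Lipschitz bound would keep every good point at distance at
        -- least δ from X₀, and X₀ - δ would be a smaller upper bound of `S`.
        e-nonneg : ∀ i → i ℕ.≤ suc m → 0# ≤ e X₀ i
        e-nonneg i i≤n = ≮⇒≥ e≮0
          where
          L = Bounds.L (bounds 0≤B i)
          0≤L = Bounds.0≤L (bounds 0≤B i)
          e≮0 : ¬ (e X₀ i < 0#)
          e≮0 e<0 = <⇒≱ 0<δ (≤-by (X₀ - δ - X₀) (x≤y⇒0≤y-x (sup-least (0# , S-0) upper))
              (solve 2 (λ x δ → δ :+ (x :- δ :- x) := :0) refl X₀ δ))
            where
            d = 0# - e X₀ i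
            small-step = positive-below (x<y⇒0<y-x e<0) 0≤L
            δ = proj₁ small-step
            0<δ = proj₁ (proj₂ small-step)
            Lδ<d = proj₂ (proj₂ small-step)
            upper : IsUpperBound S (X₀ - δ)
            upper {X} SX = ≮⇒≥ λ X₀-δ<X → <⇒≱ Lδ<d (begin
              d              ≈⟨ solve 1 (λ e → :0 :- e := :- e) refl (e X₀ i) ⟩
              - e X₀ i       ≤⟨ ≤-by (e X i) (<⇒≤ (proj₂ SX i i≤n)) (+-comm _ _) ⟩
              e X i - e X₀ i ≤⟨ decrease≤ 0≤B i (proj₁ (proj₁ SX)) (S≤X₀ SX) X₀≤B ⟩
              L * (X₀ - X)   ≤⟨ *-monoˡ-≤ 0≤L (≤-by (X - (X₀ - δ)) (x≤y⇒0≤y-x (<⇒≤ X₀-δ<X))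
                                 (solve 3 (λ X X₀ δ → X₀ :- X :+ (X :- (X₀ :- δ)) := δ) refl X X₀ δ)) ⟩
              L * δ          ∎)

        private
          positive-near : ∀ i → 0# < e X₀ i →
            ∃[ δ ] 0# < δ × (∀ {X} → X₀ ≤ X → X ≤ B → X - X₀ ≤ δ → 0# < e X i)
          positive-near i 0<e = δ , 0<δ , λ {X} X₀≤X X≤B X-X₀≤δ →
            <-≤-trans (x<y⇒0<y-x Lδ<e) (begin
              e X₀ i - L * δ
                ≤⟨ +-mono-≤ ≤-refl (-‿mono-≤ (*-monoˡ-≤ 0≤L X-X₀≤δ)) ⟩
              e X₀ i - L * (X - X₀)
                ≤⟨ +-mono-≤ ≤-refl (-‿mono-≤ (decrease≤ 0≤B i 0≤X₀ X₀≤X X≤B)) ⟩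
              e X₀ i - (e X₀ i - e X i)
                ≈⟨ solve 2 (λ x y → x :- (x :- y) := y) refl (e X₀ i) (e X i) ⟩
              e X i ∎)
            where
            L = Bounds.L (bounds 0≤B i)
            0≤L = Bounds.0≤L (bounds 0≤B i)
            small-step = positive-below 0<e 0≤L
            δ = proj₁ small-step
            0<δ = proj₁ (proj₂ small-step)
            Lδ<e = proj₂ (proj₂ small-step)

          PositiveNear : ℕ → Set
          PositiveNear n = ∃[ δ ] 0# < δ ×
            (∀ i → i ℕ.≤ n → ∀ {X} → X₀ ≤ X → X ≤ B → X - X₀ ≤ δ → 0# < e X i)

          all-positive-near : Good X₀ → ∀ n → n ℕ.≤ suc m → PositiveNear n
          all-positive-near good zero _ = 1# , 0<1 , λ { zero _ _ _ _ → 0<1 }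
          all-positive-near good (suc n) n<m =
            combine (all-positive-near good n (ℕ.<⇒≤ n<m)) (positive-near (suc n) (good (suc n) n<m))
            where
            combine : PositiveNear n →
              ∃[ δ ] 0# < δ × (∀ {X} → X₀ ≤ X → X ≤ B → X - X₀ ≤ δ → 0# < e X (suc n)) →
              PositiveNear (suc n)
            combine (δ₁ , 0<δ₁ , near₁) (δ₂ , 0<δ₂ , near₂) =
              δ , proj₁ (proj₂ common) , near
              where
              common = common-positive-bound 0<δ₁ 0<δ₂
              δ = proj₁ common
              near : ∀ i → i ℕ.≤ suc n → ∀ {X} → X₀ ≤ X → X ≤ B → X - X₀ ≤ δ → 0# < e X i
              near i i≤n X₀≤X X≤B X-X₀≤δ with ℕ.m≤n⇒m<n∨m≡n i≤n
              ... | inj₁ (s≤s i≤n) = near₁ i i≤n X₀≤X X≤B (≤-trans X-X₀≤δ (proj₁ (proj₂ (proj₂ common))))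
              ... | inj₂ ≡.refl = near₂ X₀≤X X≤B (≤-trans X-X₀≤δ (proj₂ (proj₂ (proj₂ common))))

        -- Positivity at X₀ persists on a short interval to its right, since only finitely many
        -- continuants are involved. That interval either reaches B, which is not good, or contains
        -- a good point X₀ + δ above the supremum.
        not-good : ¬ Good X₀
        not-good good = go (all-positive-near good (suc m) ℕ.≤-refl)
          where
          go : ¬ PositiveNear (suc m)
          go (δ , 0<δ , near) with ≤-or-> (B - X₀) δ
          ... | inj₁ B-X₀≤δ = ¬good λ i i≤n → near i i≤n X₀≤B ≤-refl B-X₀≤δ
          ... | inj₂ δ<B-X₀ = <⇒≱ 0<δ (≤-by (X₀ - (X₀ + δ)) (x≤y⇒0≤y-x (S≤X₀ S-X))
              (solve 2 (λ x δ → δ :+ (x :- (x :+ δ)) := :0) refl X₀ δ))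
            where
            X₀≤X : X₀ ≤ X₀ + δ
            X₀≤X = ≤-by δ (<⇒≤ 0<δ) refl
            X≤B : X₀ + δ ≤ B
            X≤B = ≤-by (B - X₀ - δ) (x≤y⇒0≤y-x (<⇒≤ δ<B-X₀))
              (solve 3 (λ x δ B → x :+ δ :+ (B :- x :- δ) := B) refl X₀ δ B)
            S-X : S (X₀ + δ)
            S-X = (≤-trans 0≤X₀ X₀≤X , X≤B) , λ i i≤n → near i i≤n X₀≤X X≤B
              (≤-reflexive (solve 2 (λ x δ → x :+ δ :- x := δ) refl X₀ δ))

        0<X₀ : 0# < X₀
        0<X₀ = 0≤X₀ , λ 0≈X₀ → not-good (good-at-0 (sym 0≈X₀))

        -- Were the continuant of size 2 + i zero, the one of size 3 + i would be - r^(i+1) X₀ e X₀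
        -- (suc i) < 0, against `e-nonneg`. The argument looks one size ahead, which is why the
        -- largest size suc m is excluded.
        e-pos : ∀ i → i ℕ.≤ m → 0# < e X₀ i
        e-pos zero _ = 0<1
        e-pos (suc zero) _ = 0<1
        e-pos (suc (suc i)) i+2≤m = e-nonneg (2 ℕ.+ i) (ℕ.m≤n⇒m≤1+n i+2≤m) , λ 0≈e →
          <⇒≱ (*-pos (*-pos (^-pos 0<r (suc i)) 0<X₀) (e-pos (suc i) (ℕ.≤-trans (ℕ.n≤1+n _) i+2≤m)))
            (≤-by (e X₀ (3 ℕ.+ i)) (e-nonneg (3 ℕ.+ i) (s≤s i+2≤m))
              (trans (solve 2 (λ x y → x :+ (y :- x) := y) refl
                (r ^ suc i * X₀ * e X₀ (suc i)) (e X₀ (2 ℕ.+ i))) (sym 0≈e)))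

        e≈0 : e X₀ (suc m) ≈ 0#
        e≈0 with ≤-or-> (e X₀ (suc m)) 0#
        ... | inj₁ e≤0 = ≤-antisym e≤0 (e-nonneg (suc m) ℕ.≤-refl)
        ... | inj₂ 0<e = ⊥-elim (not-good good)
          where
          good : Good X₀
          good i i≤n with ℕ.m≤n⇒m<n∨m≡n i≤n
          ... | inj₁ (s≤s i≤m) = e-pos i i≤m
          ... | inj₂ ≡.refl = 0<e

    -- A failure at X produces a point X₀ ≤ X where the continuant of size suc m vanishes, and then
    -- 1 ≤ X₀ Λ ≤ X Λ.
    continuant-pos : ∀ m {X} → 0# ≤ X → X * Λ (suc m) r < 1# → ∀ i → i ℕ.≤ suc m → 0# < e X i
    continuant-pos m {X} 0≤X XΛ<1 with em {∀ i → i ℕ.≤ suc m → 0# < e X i}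
    ... | yes good = good
    ... | no ¬good = ⊥-elim (<⇒≱ XΛ<1 (≤-trans
          (Eigenvector.Λ-lower 0<r (0<X₀ ¬good) m (e≈0 ¬good))
          (*-monoʳ-≤ (Λ-nonneg (suc m)) (X₀≤B ¬good))))
      where
      open FirstZero m 0≤X
      Λ-nonneg : ∀ n → 0# ≤ Λ n r
      Λ-nonneg n = ≤-respʳ-≈ (*-congˡ (sym (*-identityʳ _))) (square-nonneg (spectralRadius (A n r)))

    -- At X = 1 the continuant of size 2 is 1 - 1 = 0, so `continuant-pos` rules out Λ < 1. This
    -- makes the denominators of all `x[ k ]` positive and bounds x⋆ from above.
    1≤Λ : ∀ m → 1# ≤ Λ (2 ℕ.+ m) r
    1≤Λ m = ≮⇒≥ λ Λ<1 → proj₂ (continuant-pos (suc m) (<⇒≤ 0<1)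
      (<-respˡ-≈ (sym (*-identityˡ _)) Λ<1) 2 (s≤s (s≤s z≤n)))
      (sym (trans (+-congˡ (-‿cong (trans (*-identityʳ _) (*-identityʳ _)))) (-‿inverseʳ 1#)))

-- Comparison of complex and real continuants, and the uniform estimate.

module Bound (em : ExcludedMiddle 0ℓ) (𝓡 : CompleteOrderedField) where
  open import Data.Fin.Base using (Fin; toℕ)
  open import Data.List.Base using (List; []; _∷_)
  open import Data.List.Relation.Unary.Any using (Any; here; there)
  open import Data.Nat.Base using (zero; suc; z≤n; s≤s; _∸_)
  import Data.Nat.Properties as ℕ
  open import Data.Sum.Base using (inj₁; inj₂)
  open import Relation.Nullary using (¬_)
  open import Relation.Binary.PropositionalEquality as ≡ using (_≡_)

  open CompleteOrderedField 𝓡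
  open CommutativeRingSolver commutativeRing
  open RealField em 𝓡
  open ComplexField em 𝓡
  open Spectrum em 𝓡
  open Continuants commutativeRing
  private module ℂC = Continuants ℂ-commutativeRing
  open Analysis 𝓡 hiding (_≈_; _≤_; _<_; _+_; _*_; _-_; -_; 0#; 1#; _⁻¹; √_; sup; inf; _^_)
  open import Relation.Binary.Reasoning.PartialOrder poset
  open import Algebra.Properties.Semiring.Exp semiring
  open import Algebra.Properties.CommutativeSemiring.Exp commutativeSemiring using (^-distrib-*)

  -- The induction bounds the ratio of consecutive continuants at z by the one at ∣ z ∣ ≤ R.
  module Comparison {r R : Carrier} (z : ℂ) (0<r : 0# < r) (z≤R : ∣ z ∣ ≤ R)
    {n : ℕ} (e-pos : ∀ i → i ℕ.≤ n → 0# < E r R i) where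

    private
      e : ℕ → Carrier
      e = E r R

    c : ℕ → ℂ
    c = ℂC.continuant λ j → ι r ^ᶜ j *ᶜ z

    private
      0≤r^ : ∀ i → 0# ≤ r ^ i
      0≤r^ i = <⇒≤ (^-pos 0<r i)

      step : ∀ i → ∣ c (suc i) ∣ ≤ ∣ c (2 ℕ.+ i) ∣ + r ^ i * ∣ z ∣ * ∣ c i ∣
      step i = ≤-respʳ-≈ (+-congˡ (begin-equality
        ∣ ι r ^ᶜ i *ᶜ z *ᶜ c i ∣       ≈⟨ ∣∣-* (ι r ^ᶜ i *ᶜ z) (c i) ⟩
        ∣ ι r ^ᶜ i *ᶜ z ∣ * ∣ c i ∣    ≈⟨ *-congʳ (∣∣-* (ι r ^ᶜ i) z) ⟩
        ∣ ι r ^ᶜ i ∣ * ∣ z ∣ * ∣ c i ∣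
          ≈⟨ *-congʳ (*-congʳ (trans (∣∣-cong (ι-^ r i)) (∣ι∣ (0≤r^ i)))) ⟩
        r ^ i * ∣ z ∣ * ∣ c i ∣        ∎))
        (∣∣-minus-lower (c (suc i)) (ι r ^ᶜ i *ᶜ z *ᶜ c i))

    -- Cross-multiplied, so that it can be stated before the complex continuants are known to be
    -- nonzero; `∣c∣-pos` then derives that from it.
    ratio : ∀ i → suc i ℕ.≤ n → ∣ c i ∣ * e (suc i) ≤ ∣ c (suc i) ∣ * e i

    -- The last recurrence step is made at ∣z∣ and the earlier ones at R. Weakening ∣z∣ to R gives
    -- `ratio (suc i)`, while keeping it leaves the gap R - ∣z∣ for `quotient-bound` to exploit.
    ratio-z : ∀ i → 2 ℕ.+ i ℕ.≤ n →
      ∣ c (suc i) ∣ * (e (suc i) - r ^ i * ∣ z ∣ * e i) ≤ ∣ c (2 ℕ.+ i) ∣ * e (suc i)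
    ratio-z i i+2≤n = 0≤y-x⇒x≤y (≤-respʳ-≈ eq (+-nonneg
        (*-nonneg (x≤y⇒0≤y-x (step i)) (<⇒≤ (e-pos (suc i) i+1≤n)))
        (*-nonneg (*-nonneg (0≤r^ i) (∣∣-nonneg z)) (x≤y⇒0≤y-x (ratio i i+1≤n)))))
      where
      i+1≤n = ℕ.<⇒≤ i+2≤n
      -- The difference of the two sides is e₁ times the slack in `step i` plus ρ ∣z∣ times the
      -- slack in `ratio i`.
      eq = solve 7 (λ c₂ c₁ c₀ e₁ e₀ ρ Z →
        (c₂ :+ ρ :* Z :* c₀ :- c₁) :* e₁ :+ ρ :* Z :* (c₁ :* e₀ :- c₀ :* e₁) :=
        c₂ :* e₁ :- c₁ :* (e₁ :- ρ :* Z :* e₀)) refl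
        (∣ c (2 ℕ.+ i) ∣) (∣ c (suc i) ∣) (∣ c i ∣) (e (suc i)) (e i) (r ^ i) (∣ z ∣)

    ratio zero _ = ≤-refl
    ratio (suc i) i+2≤n = ≤-trans (*-monoˡ-≤ (∣∣-nonneg (c (suc i)))
      (+-mono-≤ ≤-refl (-‿mono-≤ (*-monoʳ-≤ (<⇒≤ (e-pos i (ℕ.<⇒≤ (ℕ.<⇒≤ i+2≤n))))
        (*-monoˡ-≤ (0≤r^ i) z≤R)))))
      (ratio-z i i+2≤n)

    ∣c∣-pos : ∀ i → i ℕ.≤ n → 0# < ∣ c i ∣
    ∣c∣-pos zero _ = <-respʳ-≈ (sym (∣ι∣ (<⇒≤ 0<1))) 0<1
    ∣c∣-pos (suc i) i<n = ∣∣-nonneg (c (suc i)) , λ 0≈∣c∣ →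
      <⇒≱ (*-pos (∣c∣-pos i (ℕ.<⇒≤ i<n)) (e-pos (suc i) i<n))
        (≤-trans (ratio i i<n) (≤-reflexive (trans (*-congʳ (sym 0≈∣c∣)) (zeroˡ _))))

    c≉0 : ∀ i → i ℕ.≤ n → ¬ (c i ≈ᶜ 0ᶜ)
    c≉0 i i≤n c≈0 = >⇒≉0 (∣c∣-pos i i≤n) (∣∣-zero c≈0)

    -- Positivity of e (2 + i) means r^i R e i < e (1 + i). Lowering R to ∣z∣ therefore leaves at
    -- least the fraction (R - ∣z∣) / R of e (1 + i), and `M` is at least the reciprocal of that
    -- fraction, whatever i is.
    quotient-bound : ∀ {M} → 1# ≤ M → R ≤ M * (R - ∣ z ∣) → ∀ i → suc i ℕ.≤ n →
      ∣ c i ∣ ≤ M * ∣ c (suc i) ∣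
    quotient-bound {M} 1≤M R≤ zero _ = ≤-respˡ-≈ (*-identityˡ _) (*-monoʳ-≤ (∣∣-nonneg (c 0)) 1≤M)
    quotient-bound {M} 1≤M R≤ (suc i) i+2≤n = *-cancelʳ-≤ (e-pos (suc i) (ℕ.<⇒≤ i+2≤n)) (begin
      ∣ c (suc i) ∣ * e (suc i)
        ≤⟨ *-monoˡ-≤ (∣∣-nonneg (c (suc i))) e≤ ⟩
      ∣ c (suc i) ∣ * (M * (e (suc i) - r ^ i * ∣ z ∣ * e i))
        ≈⟨ solve 3 (λ a M b → a :* (M :* b) := M :* (a :* b)) refl ∣ c (suc i) ∣ M _ ⟩
      M * (∣ c (suc i) ∣ * (e (suc i) - r ^ i * ∣ z ∣ * e i))
        ≤⟨ *-monoˡ-≤ (≤-trans (<⇒≤ 0<1) 1≤M) (ratio-z i i+2≤n) ⟩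
      M * (∣ c (2 ℕ.+ i) ∣ * e (suc i))
        ≈⟨ *-assoc _ _ _ ⟨
      M * ∣ c (2 ℕ.+ i) ∣ * e (suc i) ∎)
      where
      e≤ : e (suc i) ≤ M * (e (suc i) - r ^ i * ∣ z ∣ * e i)
      e≤ = 0≤y-x⇒x≤y (≤-respʳ-≈
        (solve 6 (λ M R Z e₁ e₀ ρ →
          (M :- :1) :* (e₁ :- ρ :* R :* e₀) :+ ρ :* e₀ :* (M :* (R :- Z) :- R) :=
          M :* (e₁ :- ρ :* Z :* e₀) :- e₁) refl M R (∣ z ∣) (e (suc i)) (e i) (r ^ i))
        (+-nonneg (*-nonneg (x≤y⇒0≤y-x 1≤M) (<⇒≤ (e-pos (2 ℕ.+ i) i+2≤n)))
          (*-nonneg (*-nonneg (0≤r^ i) (<⇒≤ (e-pos i (ℕ.<⇒≤ (ℕ.<⇒≤ i+2≤n)))))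
            (x≤y⇒0≤y-x R≤))))

  -- The radius x⋆ and the factors D k for fixed p and q.

  module Radius {p q : Carrier} (0<p : 0# < p) (0<q : 0# < q) where
    r : Carrier
    r = q ^ 2 * (p ^ 2) ⁻¹

    0<r : 0# < r
    0<r = *-pos (^-pos 0<q 2) (⁻¹-pos (^-pos 0<p 2))

    g : ℕ → Carrier
    g k = p ^ (2 ℕ.* k ∸ 1) * q

    0<g : ∀ k → 0# < g k
    0<g k = *-pos (^-pos 0<p (2 ℕ.* k ∸ 1)) 0<q

    0<gΛ : ∀ j → 0# < g (suc j) * Λ (2 ℕ.+ j) r
    0<gΛ j = *-pos (0<g (suc j)) (<-≤-trans 0<1 (ContinuantSign.1≤Λ 0<r j))

    x⋆≤x : ∀ j → x⋆ p q ≤ x[ suc j ] p q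
    x⋆≤x j = inf-lower 0# 0≤x (suc j , s≤s z≤n , refl)
      where
      0≤x : ∀ {t} → ∃[ k ] 1 ℕ.≤ k × t ≈ x[ k ] p q → 0# ≤ t
      0≤x (suc j , _ , t≈x) = ≤-respʳ-≈ (sym t≈x) (<⇒≤ (⁻¹-pos (0<gΛ j)))

    -- The index k = 1 suffices: x₁ = 1 / (p q Λ₂) with Λ₂ ≥ 1.
    x⋆-bound : ∀ {δ} → 0# < δ → δ ≤ p → δ ≤ q → x⋆ p q ≤ (δ * δ) ⁻¹
    x⋆-bound {δ} 0<δ δ≤p δ≤q = ≤-trans (x⋆≤x 0) (⁻¹-antitone (*-pos 0<δ 0<δ) (begin
      δ * δ              ≈⟨ trans (*-identityʳ _) (*-congʳ (*-identityʳ δ)) ⟨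
      δ ^ 1 * δ * 1#     ≤⟨ *-mono-≤ (<⇒≤ (*-pos (^-pos 0<δ 1) 0<δ)) (<⇒≤ 0<1)
                             (*-mono-≤ (<⇒≤ (^-pos 0<δ 1)) (<⇒≤ 0<δ) (^-monoˡ-≤ (<⇒≤ 0<δ) δ≤p 1) δ≤q)
                             (ContinuantSign.1≤Λ 0<r 0) ⟩
      g 1 * Λ 2 r        ∎))

    -- X lies below x_k for k = suc j, and this says that (g k X) Λ (k + 1) < 1.
    continuant-pos-below-x⋆ : ∀ j {X} → 0# ≤ X → X < x⋆ p q →
      ∀ i → i ℕ.≤ 2 ℕ.+ j → 0# < E r (g (suc j) * X) i
    continuant-pos-below-x⋆ j {X} 0≤X X<x⋆ =
      ContinuantSign.continuant-pos 0<r (suc j) (*-nonneg (<⇒≤ (0<g (suc j))) 0≤X) (begin-strict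
        g (suc j) * X * Λ (2 ℕ.+ j) r
          ≈⟨ solve 3 (λ a b c → a :* b :* c := b :* (a :* c)) refl (g (suc j)) X (Λ (2 ℕ.+ j) r) ⟩
        X * (g (suc j) * Λ (2 ℕ.+ j) r)
          <⟨ *-monoʳ-< (0<gΛ j) (<-≤-trans X<x⋆ (x⋆≤x j)) ⟩
        x[ suc j ] p q * (g (suc j) * Λ (2 ℕ.+ j) r)
          ≈⟨ ⁻¹-inverseˡ (>⇒≉0 (0<gΛ j)) ⟩
        1# ∎)

    private
      Qr≈1 : Qarg p q *ᶜ ι r ≈ᶜ ℂ.1#
      Qr≈1 = ℂ.trans (ι-* (p ^ 2 * (q ^ 2) ⁻¹) r) (ι-cong (begin-equality
        p ^ 2 * (q ^ 2) ⁻¹ * (q ^ 2 * (p ^ 2) ⁻¹)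
          ≈⟨ solve 4 (λ a b c d → a :* b :* (c :* d) := a :* d :* (c :* b)) refl
               (p ^ 2) ((q ^ 2) ⁻¹) (q ^ 2) ((p ^ 2) ⁻¹) ⟩
        p ^ 2 * (p ^ 2) ⁻¹ * (q ^ 2 * (q ^ 2) ⁻¹)
          ≈⟨ *-cong (⁻¹-inverseʳ (>⇒≉0 (^-pos 0<p 2))) (⁻¹-inverseʳ (>⇒≉0 (^-pos 0<q 2))) ⟩
        1# * 1#  ≈⟨ *-identityʳ 1# ⟩
        1#       ∎))

      odd-power : ∀ x j → x ^ (2 ℕ.* suc j ∸ 1) ≈ x * (x ^ 2) ^ j
      odd-power x j = begin-equality
        x ^ (j ℕ.+ suc (j ℕ.+ 0))  ≡⟨ ≡.cong (x ^_) (ℕ.+-suc j (j ℕ.+ 0)) ⟩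
        x * x ^ (2 ℕ.* j)          ≈⟨ *-congˡ (^-assocʳ x 2 j) ⟨
        x * (x ^ 2) ^ j            ∎

      -- The radius x_k is defined with the scale p^(2k-1) q and ratio q²/p², whereas `D k` is
      -- evaluated at the scale q^(2k-1) p and ratio p²/q². They describe one weight sequence, read
      -- from opposite ends.
      r^*g : ∀ j → r ^ j * g (suc j) ≈ q ^ (2 ℕ.* suc j ∸ 1) * p
      r^*g j = begin-equality
        r ^ j * (p ^ (2 ℕ.* suc j ∸ 1) * q)
          ≈⟨ *-congˡ (*-congʳ (odd-power p j)) ⟩
        r ^ j * (p * (p ^ 2) ^ j * q)
          ≈⟨ solve 4 (λ r p P q → r :* (p :* P :* q) := q :* (r :* P) :* p) refl (r ^ j) p ((p ^ 2) ^ j) q ⟩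
        q * (r ^ j * (p ^ 2) ^ j) * p
          ≈⟨ *-congʳ (*-congˡ (^-distrib-* r (p ^ 2) j)) ⟨
        q * (r * p ^ 2) ^ j * p
          ≈⟨ *-congʳ (*-congˡ (^-congˡ j (trans (*-assoc _ _ _)
               (trans (*-congˡ (⁻¹-inverseˡ (>⇒≉0 (^-pos 0<p 2)))) (*-identityʳ _))))) ⟩
        q * (q ^ 2) ^ j * p  ≈⟨ *-congʳ (odd-power q j) ⟨
        q ^ (2 ℕ.* suc j ∸ 1) * p ∎

    module _ {x : ℂ} {X M : Carrier} (x≤X : ∣ x ∣ ≤ X) (X<x⋆ : X < x⋆ p q)
      (1≤M : 1# ≤ M) (X≤M : X ≤ M * (X - ∣ x ∣)) where

      module _ (j : ℕ) where
        private
          z : ℂ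
          z = ι (g (suc j)) *ᶜ x

          ∣z∣ : ∣ z ∣ ≈ g (suc j) * ∣ x ∣
          ∣z∣ = trans (∣∣-* (ι (g (suc j))) x) (*-congʳ (∣ι∣ (<⇒≤ (0<g (suc j)))))

          z≤ : ∣ z ∣ ≤ g (suc j) * X
          z≤ = ≤-respˡ-≈ (sym ∣z∣) (*-monoˡ-≤ (<⇒≤ (0<g (suc j))) x≤X)

          open Comparison z 0<r z≤
            (continuant-pos-below-x⋆ j (≤-trans (∣∣-nonneg x) x≤X) X<x⋆)

          Xarg≈ : Xarg (suc j) x p q ≈ᶜ ι r ^ᶜ j *ᶜ z
          Xarg≈ = ℂ.sym (ℂ.trans (ℂ.sym (ℂ.*-assoc (ι r ^ᶜ j) (ι (g (suc j))) x))
            (ℂ.*-congʳ {x} (ℂ.trans (ℂ.*-congʳ {ι (g (suc j))} (ι-^ r j))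
              (ℂ.trans (ι-* (r ^ j) (g (suc j))) (ι-cong (r^*g j))))))

          open ℂC.Reversal Qr≈1 z

          den : ℂ
          den = P (2 ℕ.+ j) (Xarg (suc j) x p q) (Qarg p q)

          den≈ : den ≈ᶜ c (2 ℕ.+ j)
          den≈ = denominator j Xarg≈

        denominator≉0 : ¬ (P (2 ℕ.+ j) (Xarg (suc j) x p q) (Qarg p q) ≈ᶜ 0ᶜ)
        denominator≉0 den≈0 = c≉0 (2 ℕ.+ j) ℕ.≤-refl (ℂ.trans (ℂ.sym den≈) den≈0)

        ∣D∣≤M : ∣ D (suc j) (Xarg (suc j) x p q) (Qarg p q) ∣ ≤ M
        ∣D∣≤M = begin
          ∣ num *ᶜ den ⁻¹ᶜ ∣
            ≈⟨ ∣∣-* num (den ⁻¹ᶜ) ⟩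
          ∣ num ∣ * ∣ den ⁻¹ᶜ ∣
            ≈⟨ *-congʳ (∣∣-cong (numerator j Xarg≈)) ⟩
          ∣ c (suc j) ∣ * ∣ den ⁻¹ᶜ ∣
            ≤⟨ *-monoʳ-≤ (∣∣-nonneg (den ⁻¹ᶜ)) (quotient-bound 1≤M gX≤ (suc j) ℕ.≤-refl) ⟩
          M * ∣ c (2 ℕ.+ j) ∣ * ∣ den ⁻¹ᶜ ∣
            ≈⟨ *-congʳ (*-congˡ (∣∣-cong den≈)) ⟨
          M * ∣ den ∣ * ∣ den ⁻¹ᶜ ∣
            ≈⟨ trans (*-assoc _ _ _) (*-congˡ (trans (*-comm _ _) (∣⁻¹ᶜ∣ denominator≉0))) ⟩
          M * 1#  ≈⟨ *-identityʳ M ⟩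
          M       ∎
          where
          num = P (suc j) (Qarg p q *ᶜ Xarg (suc j) x p q) (Qarg p q)
          -- The condition on `M` is homogeneous in X and ∣x∣, so one `M` serves every j.
          gX≤ : g (suc j) * X ≤ M * (g (suc j) * X - ∣ z ∣)
          gX≤ = begin
            g (suc j) * X
              ≤⟨ *-monoˡ-≤ (<⇒≤ (0<g (suc j))) X≤M ⟩
            g (suc j) * (M * (X - ∣ x ∣))
              ≈⟨ solve 4 (λ g M X x → g :* (M :* (X :- x)) := M :* (g :* X :- g :* x)) refl
                   (g (suc j)) M X (∣ x ∣) ⟩
            M * (g (suc j) * X - g (suc j) * ∣ x ∣)
              ≈⟨ *-congˡ (+-congˡ (-‿cong ∣z∣)) ⟨
            M * (g (suc j) * X - ∣ z ∣) ∎

  -- Of the factors bounded by M there are 2h - 1; since M ≥ 1, one more is added to reach (M M)^h.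
  ∣product∣-bound : ∀ {x y q B Y s M} (F : ℕ → ℂ) →
    0# ≤ q → q ≤ s → ∣ x ∣ ≤ B → ∣ y ∣ ≤ Y → 1# ≤ M → (∀ j → ∣ F (suc j) ∣ ≤ M) →
    ∀ h → 1 ℕ.≤ h →
    ∣ x ^ᶜ h *ᶜ y ^ᶜ h *ᶜ ι q ^ᶜ (h ℕ.* h) *ᶜ productᶜ {h ∸ 1} (λ i → F (suc (toℕ i))) ^ᶜ 2 *ᶜ F h ∣ ≤
      (B * Y * (M * M)) ^ h * s ^ (h ℕ.* h)
  ∣product∣-bound {x} {y} {q} {B} {Y} {s} {M} F 0≤q q≤s x≤B y≤Y 1≤M F≤M h@(suc j) _ = begin
    ∣ a *ᶜ b *ᶜ c *ᶜ Π ^ᶜ 2 *ᶜ F h ∣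
      ≤⟨ *-≤ (a *ᶜ b *ᶜ c *ᶜ Π ^ᶜ 2) (F h)
         (*-≤ (a *ᶜ b *ᶜ c) (Π ^ᶜ 2)
         (*-≤ (a *ᶜ b) c
         (*-≤ a b (power≤ x h x≤B) (power≤ y h y≤Y))
           (power≤ (ι q) (h ℕ.* h) (≤-trans (≤-reflexive (∣ι∣ 0≤q)) q≤s)))
           (power≤ Π 2 (∣∣-product {j} (λ i → F (suc (toℕ i))) λ i → F≤M (toℕ i))))
           (≤-trans (F≤M j) M≤MM) ⟩
    B ^ h * Y ^ h * s ^ (h ℕ.* h) * (M ^ j) ^ 2 * (M * M)
      ≈⟨ *-congʳ (*-congˡ (trans (*-congˡ (*-identityʳ _)) (sym (^-distrib-* M M j)))) ⟩
    B ^ h * Y ^ h * s ^ (h ℕ.* h) * (M * M) ^ j * (M * M)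
      ≈⟨ solve 5 (λ b y s m n → b :* y :* s :* m :* n := b :* y :* (n :* m) :* s) refl
           (B ^ h) (Y ^ h) (s ^ (h ℕ.* h)) ((M * M) ^ j) (M * M) ⟩
    B ^ h * Y ^ h * (M * M) ^ h * s ^ (h ℕ.* h)
      ≈⟨ *-congʳ (trans (^-distrib-* (B * Y) (M * M) h) (*-congʳ (^-distrib-* B Y h))) ⟨
    (B * Y * (M * M)) ^ h * s ^ (h ℕ.* h) ∎
    where
    Π = productᶜ {h ∸ 1} λ i → F (suc (toℕ i))
    a = x ^ᶜ h
    b = y ^ᶜ h
    c = ι q ^ᶜ (h ℕ.* h)
    *-≤ : ∀ z w {u v} → ∣ z ∣ ≤ u → ∣ w ∣ ≤ v → ∣ z *ᶜ w ∣ ≤ u * v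
    *-≤ z w z≤u w≤v = ≤-trans (≤-reflexive (∣∣-* z w)) (*-mono-≤ (∣∣-nonneg z) (∣∣-nonneg w) z≤u w≤v)
    power≤ : ∀ z {b} n → ∣ z ∣ ≤ b → ∣ z ^ᶜ n ∣ ≤ b ^ n
    power≤ z n z≤b = ≤-trans (≤-reflexive (∣∣-^ z n)) (^-monoˡ-≤ (∣∣-nonneg z) z≤b n)
    M≤MM : M ≤ M * M
    M≤MM = ≤-respˡ-≈ (*-identityˡ M) (*-monoʳ-≤ (≤-trans (<⇒≤ 0<1) 1≤M) 1≤M)

  -- Choose N with W s^N ≤ 1. Because (N+1) h ≤ h² + (N+1)² for every h, the factor s^(h²) is at
  -- most s^((N+1)h) / S with S = s^((N+1)²). Of this power, s^(Nh) absorbs W^h and s^h remains as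
  -- the geometric decay, so C = 1/S works for all h at once.
  gaussian-decay : ∀ {W s} → 0# ≤ W → 0# < s → s < 1# →
    ∃[ C ] (∀ h → W ^ h * s ^ (h ℕ.* h) ≤ C * s ^ h)
  gaussian-decay {W} {s} 0≤W 0<s s<1 with power-below W 0<s s<1
  ... | N , WsN≤1 = S ⁻¹ , λ h → *-cancelʳ-≤ 0<S (begin
      W ^ h * s ^ (h ℕ.* h) * S
        ≈⟨ trans (*-assoc _ _ _) (*-congˡ (sym (^-homo-* s (h ℕ.* h) (suc N ℕ.* suc N)))) ⟩
      W ^ h * s ^ (h ℕ.* h ℕ.+ suc N ℕ.* suc N)
        ≤⟨ *-monoˡ-≤ (^-nonneg 0≤W h) (^-antitone (<⇒≤ 0<s) (<⇒≤ s<1) (exponent h)) ⟩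
      W ^ h * s ^ (h ℕ.+ N ℕ.* h)
        ≈⟨ *-congˡ (trans (^-homo-* s h (N ℕ.* h)) (*-congˡ (sym (^-assocʳ s N h)))) ⟩
      W ^ h * (s ^ h * (s ^ N) ^ h)
        ≈⟨ solve 3 (λ a b c → a :* (b :* c) := a :* c :* b) refl (W ^ h) (s ^ h) ((s ^ N) ^ h) ⟩
      W ^ h * (s ^ N) ^ h * s ^ h
        ≈⟨ *-congʳ (^-distrib-* W (s ^ N) h) ⟨
      (W * s ^ N) ^ h * s ^ h
        ≤⟨ *-monoʳ-≤ (<⇒≤ (^-pos 0<s h))
             (^-≤1 (*-nonneg 0≤W (<⇒≤ (^-pos 0<s N))) WsN≤1 h) ⟩
      1# * s ^ h
        ≈⟨ *-congʳ (⁻¹-inverseˡ (>⇒≉0 0<S)) ⟨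
      S ⁻¹ * S * s ^ h
        ≈⟨ solve 3 (λ a b c → a :* b :* c := a :* c :* b) refl (S ⁻¹) S (s ^ h) ⟩
      S ⁻¹ * s ^ h * S ∎)
    where
    S = s ^ (suc N ℕ.* suc N)
    0<S = ^-pos 0<s (suc N ℕ.* suc N)
    exponent : ∀ h → suc N ℕ.* h ℕ.≤ h ℕ.* h ℕ.+ suc N ℕ.* suc N
    exponent h with ℕ.≤-total h (suc N)
    ... | inj₁ h≤N = ℕ.≤-trans (ℕ.*-monoʳ-≤ (suc N) h≤N) (ℕ.m≤n+m _ _)
    ... | inj₂ N≤h = ℕ.≤-trans (ℕ.*-monoˡ-≤ h N≤h) (ℕ.m≤m+n _ _)

  -- Compactness and the choice of constants.

  -- The open sets where p, q and 1 - q all exceed δ cover K as δ runs over the positive reals; the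
  -- smallest δ in a finite subcover is the margin.
  compact-margin : (K : Pred (ℝ × ℝ) 0ℓ) → IsCompact K →
    (∀ p q → K (p , q) → (0# < p × p < 1#) × (0# < q × q < 1#)) →
    ∃[ δ ] 0# < δ × δ < 1# × (∀ p q → K (p , q) → (δ ≤ p × δ ≤ q) × δ ≤ 1# - q)
  compact-margin K compact K⊆ = finish (compact I U U-open U-cover)
    where
    I : Set
    I = ∃[ δ ] 0# < δ

    U : I → Pred (ℝ × ℝ) 0ℓ
    U (δ , _) (p , q) = (δ < p × δ < q) × δ < 1# - q

    smaller-positive : ∀ {d} → 0# < d → ∃[ δ ] 0# < δ × δ < d
    smaller-positive 0<d = let (δ , 0<δ , 1δ<d) = positive-below 0<d (<⇒≤ 0<1) in
      δ , 0<δ , <-respˡ-≈ (*-identityˡ δ) 1δ<d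

    U-open : ∀ i → IsOpen (U i)
    U-open (δ , _) p q ((δ<p , δ<q) , δ<1-q) =
      neighbourhood (common-positive-bound₃ (x<y⇒0<y-x δ<p) (x<y⇒0<y-x δ<q) (x<y⇒0<y-x δ<1-q))
      where
      below : ∀ {x η} → η ≤ x - δ → δ ≤ x - η
      below {x} {η} η≤x-δ = ≤-by (x - δ - η) (x≤y⇒0≤y-x η≤x-δ)
        (solve 3 (λ x δ η → δ :+ (x :- δ :- η) := x :- η) refl x δ η)
      above : ∀ {η q′} → η ≤ 1# - q - δ → q′ < q + η → δ < 1# - q′
      above {η} {q′} η≤ q′<q+η = 0<y-x⇒x<y (<-≤-trans (x<y⇒0<y-x q′<q+η)
        (≤-by (1# - q - δ - η) (x≤y⇒0≤y-x η≤)
        (solve 4 (λ q η q′ δ → q :+ η :- q′ :+ (:1 :- q :- δ :- η) := :1 :- q′ :- δ) refl q η q′ δ)))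
      neighbourhood : ∃[ η ] 0# < η × (η ≤ p - δ × η ≤ q - δ) × η ≤ 1# - q - δ →
        ∃[ η ] 0# < η × (∀ p′ q′ →
          p - η < p′ → p′ < p + η → q - η < q′ → q′ < q + η → (δ < p′ × δ < q′) × δ < 1# - q′)
      neighbourhood (η , 0<η , (η≤p , η≤q) , η≤1-q) = η , 0<η , λ p′ q′ p-η<p′ _ q-η<q′ q′<q+η →
        (≤-<-trans (below η≤p) p-η<p′ , ≤-<-trans (below η≤q) q-η<q′) , above η≤1-q q′<q+η

    U-cover : ∀ z → K z → ∃[ i ] U i z
    U-cover (p , q) Kpq = shrink (common-positive-bound₃
        (proj₁ (proj₁ bounds)) (proj₁ (proj₂ bounds)) (x<y⇒0<y-x (proj₂ (proj₂ bounds))))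
      where
      bounds = K⊆ p q Kpq
      shrink : ∃[ η ] 0# < η × (η ≤ p × η ≤ q) × η ≤ 1# - q → ∃[ i ] U i (p , q)
      shrink (η , 0<η , (η≤p , η≤q) , η≤1-q) =
        let (δ , 0<δ , δ<η) = smaller-positive 0<η in
        (δ , 0<δ) , (<-≤-trans δ<η η≤p , <-≤-trans δ<η η≤q) , <-≤-trans δ<η η≤1-q

    Margin : List I → Set
    Margin is = ∃[ δ ] 0# < δ × δ < 1# ×
      (∀ p q → Any (λ i → U i (p , q)) is → (δ ≤ p × δ ≤ q) × δ ≤ 1# - q)

    extend : ∀ i is → Margin is → Margin (i ∷ is)
    extend (δ₁ , 0<δ₁) is (δ₂ , 0<δ₂ , δ₂<1 , δ₂≤) = shrink (common-positive-bound 0<δ₁ 0<δ₂)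
      where
      shrink : ∃[ δ ] 0# < δ × δ ≤ δ₁ × δ ≤ δ₂ → Margin ((δ₁ , 0<δ₁) ∷ is)
      shrink (δ , 0<δ , δ≤δ₁ , δ≤δ₂) = δ , 0<δ , ≤-<-trans δ≤δ₂ δ₂<1 , λ where
        p q (here ((δ₁<p , δ₁<q) , δ₁<1-q)) →
          (≤-trans δ≤δ₁ (<⇒≤ δ₁<p) , ≤-trans δ≤δ₁ (<⇒≤ δ₁<q)) , ≤-trans δ≤δ₁ (<⇒≤ δ₁<1-q)
        p q (there any) → let ((≤p , ≤q) , ≤1-q) = δ₂≤ p q any in
          (≤-trans δ≤δ₂ ≤p , ≤-trans δ≤δ₂ ≤q) , ≤-trans δ≤δ₂ ≤1-q

    margin : ∀ is → Margin is
    -- An empty subcover must still yield some δ strictly between 0 and 1, since 1 - δ is to serve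
    -- as a decay rate.
    margin [] = let (δ , 0<δ , δ<1) = smaller-positive 0<1 in δ , 0<δ , δ<1 , λ _ _ ()
    margin (i ∷ is) = extend i is (margin is)

    finish : Σ (List I) (λ is → ∀ z → K z → Any (λ i → U i z) is) →
      ∃[ δ ] 0# < δ × δ < 1# × (∀ p q → K (p , q) → (δ ≤ p × δ ≤ q) × δ ≤ 1# - q)
    finish (is , covers) =
      let (δ , 0<δ , δ<1 , δ≤) = margin is in δ , 0<δ , δ<1 , λ p q Kpq → δ≤ p q (covers (p , q) Kpq)

  module Estimate {δ ε Y : ℝ} (0<δ : 0# < δ) (δ<1 : δ < 1#) (0<ε : 0# < ε) (0≤Y : 0# ≤ Y) where
    -- `s` bounds q and becomes θ, `B` bounds x⋆ and ∣x∣, and `M` bounds every D k. The choice of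
    -- `M` makes M (ε δ) = B + ε δ, which exceeds X, while ε δ is the least distance from ∣x∣ to X.
    s B M W : ℝ
    s = 1# - δ
    B = (δ * δ) ⁻¹
    M = B * (ε * δ) ⁻¹ + 1#
    W = B * Y * (M * M)

    0<s : 0# < s
    0<s = x<y⇒0<y-x δ<1

    s<1 : s < 1#
    s<1 = 0<y-x⇒x<y (<-respʳ-≈ (solve 2 (λ δ o → δ := o :- (o :- δ)) refl δ 1#) 0<δ)

    private
      0<B : 0# < B
      0<B = ⁻¹-pos (*-pos 0<δ 0<δ)

      0<εδ : 0# < ε * δ
      0<εδ = *-pos 0<ε 0<δ

      1≤M : 1# ≤ M
      1≤M = ≤-by (B * (ε * δ) ⁻¹) (<⇒≤ (*-pos 0<B (⁻¹-pos 0<εδ))) (+-comm _ _)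

      0≤M : 0# ≤ M
      0≤M = ≤-trans (<⇒≤ 0<1) 1≤M

    0≤W : 0# ≤ W
    0≤W = *-nonneg (*-nonneg (<⇒≤ 0<B) 0≤Y) (*-nonneg 0≤M 0≤M)

    module _ {p q : ℝ} (δ≤p : δ ≤ p) (δ≤q : δ ≤ q) (δ≤1-q : δ ≤ 1# - q)
      {x y : ℂ} (y≤Y : ∣ y ∣ ≤ Y) (x≤ : ∣ x ∣ ≤ x⋆ p q - ε) where

      private
        0<q = <-≤-trans 0<δ δ≤q

        open Radius (<-≤-trans 0<δ δ≤p) 0<q

        -- The intermediate radius. It is ε s below x⋆, and at least ε - ε s = ε δ above ∣x∣.
        X : ℝ
        X = x⋆ p q - ε * s

        x⋆≤B : x⋆ p q ≤ B
        x⋆≤B = x⋆-bound 0<δ δ≤p δ≤q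

        X<x⋆ : X < x⋆ p q
        X<x⋆ = 0<y-x⇒x<y (<-respʳ-≈
          (solve 2 (λ x e → e := x :- (x :- e)) refl (x⋆ p q) (ε * s)) (*-pos 0<ε 0<s))

        εδ≤X-x : ε * δ ≤ X - ∣ x ∣
        εδ≤X-x = ≤-by (x⋆ p q - ε - ∣ x ∣) (x≤y⇒0≤y-x x≤)
          (solve 4 (λ ε δ x⋆ x → ε :* δ :+ (x⋆ :- ε :- x) := x⋆ :- ε :* (:1 :- δ) :- x) refl
            ε δ (x⋆ p q) (∣ x ∣))

        x≤X : ∣ x ∣ ≤ X
        x≤X = 0≤y-x⇒x≤y (≤-trans (<⇒≤ 0<εδ) εδ≤X-x)

        X≤M[X-x] : X ≤ M * (X - ∣ x ∣)
        X≤M[X-x] = begin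
          X                            ≤⟨ <⇒≤ X<x⋆ ⟩
          x⋆ p q                       ≤⟨ x⋆≤B ⟩
          B                            ≤⟨ ≤-by (ε * δ) (<⇒≤ 0<εδ) refl ⟩
          B + ε * δ                    ≈⟨ +-congʳ (*-identityʳ B) ⟨
          B * 1# + ε * δ               ≈⟨ +-congʳ (*-congˡ (⁻¹-inverseˡ (>⇒≉0 0<εδ))) ⟨
          B * ((ε * δ) ⁻¹ * (ε * δ)) + ε * δ
            ≈⟨ solve 3 (λ B a b → B :* (a :* b) :+ b := (B :* a :+ :1) :* b) refl B ((ε * δ) ⁻¹) (ε * δ) ⟩
          M * (ε * δ)                  ≤⟨ *-monoˡ-≤ 0≤M εδ≤X-x ⟩
          M * (X - ∣ x ∣)              ∎

        x≤B : ∣ x ∣ ≤ B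
        x≤B = ≤-trans x≤X (≤-trans (<⇒≤ X<x⋆) x⋆≤B)

        q≤s : q ≤ s
        q≤s = ≤-by (1# - q - δ) (x≤y⇒0≤y-x δ≤1-q)
          (solve 2 (λ q δ → q :+ (:1 :- q :- δ) := :1 :- δ) refl q δ)

      defined : ∀ h → GDefined h x p q
      defined h (suc j) _ _ = denominator≉0 x≤X X<x⋆ 1≤M X≤M[X-x] j

      ∣G∣-bound : ∀ h → 1 ℕ.≤ h → ∣ G h x y p q ∣ ≤ W ^ h * s ^ (h ℕ.* h)
      ∣G∣-bound = ∣product∣-bound {x} {y} {q} {B} {Y} {s} {M}
        (λ k → D k (Xarg k x p q) (Qarg p q))
        (<⇒≤ 0<q) q≤s x≤B y≤Y 1≤M (∣D∣≤M x≤X X<x⋆ 1≤M X≤M[X-x])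

proposition7p5 : ExcludedMiddle 0ℓ → (𝓡 : CompleteOrderedField) → let open Analysis 𝓡 in
    (K : Pred (ℝ × ℝ) 0ℓ) → IsCompact K →
    (∀ p q → K (p , q) → (0# < p × p < 1#) × (0# < q × q < 1#)) →
    (Y : ℝ) → 0# ≤ Y →
    (ε : ℝ) → 0# < ε →
    ε < inf (λ t → ∃[ p ] ∃[ q ] K (p , q) × t ≈ x⋆ p q) →
    ∃[ C ] ∃[ θ ] 0# < θ × θ < 1# ×
    (∀ h → 1 ℕ.≤ h →
    ∀ p q → K (p , q) →
    ∀ y → ∣ y ∣ ≤ Y →
    ∀ x → ∣ x ∣ ≤ x⋆ p q - ε →
    GDefined h x p q × ∣ G h x y p q ∣ ≤ C * θ ^ h)
proposition7p5 em 𝓡 K compact K⊆ Y 0≤Y ε 0<ε _ = conclude (compact-margin K compact K⊆)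
  where
  open Analysis 𝓡
  open RealField em 𝓡 using (≤-trans)
  open Bound em 𝓡
  conclude : ∃[ δ ] 0# < δ × δ < 1# × (∀ p q → K (p , q) → (δ ≤ p × δ ≤ q) × δ ≤ 1# - q) →
    ∃[ C ] ∃[ θ ] 0# < θ × θ < 1# × (∀ h → 1 ℕ.≤ h → ∀ p q → K (p , q) → ∀ y → ∣ y ∣ ≤ Y →
      ∀ x → ∣ x ∣ ≤ x⋆ p q - ε → GDefined h x p q × ∣ G h x y p q ∣ ≤ C * θ ^ h)
  -- The constants depend only on δ, ε and Y, so they are fixed before h, p, q, x and y are
  -- introduced.
  conclude (δ , 0<δ , δ<1 , margin) = C , s , 0<s , s<1 , λ h 1≤h p q Kpq y y≤Y x x≤ →
      let ((δ≤p , δ≤q) , δ≤1-q) = margin p q Kpq in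
      defined δ≤p δ≤q δ≤1-q {x} {y} y≤Y x≤ h ,
      ≤-trans (∣G∣-bound δ≤p δ≤q δ≤1-q {x} {y} y≤Y x≤ h 1≤h) (decay h)
    where
    open Estimate 0<δ δ<1 0<ε 0≤Y
    C = proj₁ (gaussian-decay 0≤W 0<s s<1)
    decay = proj₂ (gaussian-decay 0≤W 0<s s<1)
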